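{- Let $w_1,w_2,w_3$ be positive integers such that $r$ divides none of $w_2w_3$, $w_1w_3$, $w_1w_2$. Then for every integer $n\ge 0$, as identities of polynomials in $y_1,y_2,y_3$, $$\begin{aligned} &\sum_{k+l+m=n}\binom{n}{k,l,m}B_{k,\chi,\xi^{w_2w_3}}(w_1y_1)B_{l,\chi,\xi^{w_1w_3}}(w_2y_2)B_{m,\chi,\xi^{w_1w_2}}(w_3y_3)\,w_1^{l+m}w_2^{k+m}w_3^{k+l}\\ &=\sum_{k+l+m=n}\binom{n}{k,l,m}B_{k,\chi,\xi^{w_2w_3}}(w_1y_1)B_{l,\chi,\xi^{w_1w_2}}(w_3y_2)B_{m,\chi,\xi^{w_1w_3}}(w_2y_3)\,w_1^{l+m}w_3^{k+m}w_2^{k+l}\\ &=\sum_{k+l+m=n}\binom{n}{k,l,m}B_{k,\chi,\xi^{w_1w_3}}(w_2y_1)B_{l,\chi,\xi^{w_2w_3}}(w_1y_2)B_{m,\chi,\xi^{w_1w_2}}(w_3y_3)\,w_2^{l+m}w_1^{k+m}w_3^{k+l}\\ &=\sum_{k+l+m=n}\binom{n}{k,l,m}B_{k,\chi,\xi^{w_1w_3}}(w_2y_1)B_{l,\chi,\xi^{w_1w_2}}(w_3y_2)B_{m,\chi,\xi^{w_2w_3}}(w_1y_3)\,w_2^{l+m}w_3^{k+m}w_1^{k+l}\\ &=\sum_{k+l+m=n}\binom{n}{k,l,m}B_{k,\chi,\xi^{w_1w_2}}(w_3y_1)B_{l,\chi,\xi^{w_2w_3}}(w_1y_2)B_{m,\chi,\xi^{w_1w_3}}(w_2y_3)\,w_3^{l+m}w_1^{k+m}w_2^{k+l}\\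 &=\sum_{k+l+m=n}\binom{n}{k,l,m}B_{k,\chi,\xi^{w_1w_2}}(w_3y_1)B_{l,\chi,\xi^{w_1w_3}}(w_2y_2)B_{m,\chi,\xi^{w_2w_3}}(w_1y_3)\,w_3^{l+m}w_2^{k+m}w_1^{k+l}. \end{aligned}$$
   Context: Let $p$ be a prime, $\mathbb{C}_p$ the completion of an algebraic closure of $\mathbb{Q}_p$, $d$ a positive integer, and $\chi$ a primitive Dirichlet character of conductor $d$, with values viewed in $\mathbb{C}_p$ via a fixed embedding $\overline{\mathbb{Q}}\to\mathbb{C}_p$ (as usual $\chi(a)=0$ if $\gcd(a,d)>1$; for $d=1$, $\chi\equiv 1$). Let $r$ be a positive integer with $\gcd(r,pd)=1$ and let $\xi\neq 1$ in $\mathbb{C}_p$ be an $r$-th root of unity. For a root of unity $\eta\in\mathbb{C}_p$, the generalized twisted Bernoulli polynomials $B_{n,\chi,\eta}(x)$ attached to $\chi$ and $\eta$ are defined by the power series identity $$\frac{t\,e^{xt}}{\eta^{d}e^{dt}-1}\sum_{a=0}^{d-1}\chi(a)\eta^{a}e^{at}=\sum_{n=0}^{\infty}B_{n,\chi,\eta}(x)\frac{t^{n}}{n!}.$$ (The left side is a power series in $t$ with coefficients in $\mathbb{C}_p[x]$, for any $\eta$.) Sums over $k+l+m=n$ run over all nonnegative integers $k,l,m$ with $k+l+m=n$, and $\binom{n}{k,l,m}=\frac{n!}{k!\,l!\,m!}$. -}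

module Defs where

open import Level using (Level; 0ℓ)
open import Algebra.Apartness.Bundles using (HeytingField; HeytingCommutativeRing)
open import Algebra.Bundles using (CommutativeRing)
open import Algebra.Bundles.Raw using (RawRing)
open import Algebra.Morphism.Structures using (module RingMorphisms)
import Algebra.Definitions.RawSemiring as RawSemiringDefs
open import Data.Fin.Base using (toℕ)
open import Data.Integer.Base as ℤ using (ℤ; +_)
import Data.Integer.Coprimality as ℤ
import Data.Integer.Divisibility as ℤ
open import Data.List.Base using (List; []; _∷_; map; foldr)
open import Data.Nat.Base as ℕ using (ℕ; zero; NonZero; _∸_; _!)
import Data.Nat.Divisibility as ℕ
import Data.Nat.Properties as ℕ
open import Data.Product.Base using (∃; Σ-syntax; _×_)
open import Data.Rational.Base as ℚ using (ℚ)
import Data.Rational.Properties as ℚ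
open import Data.Vec.Functional using (Vector)
open import Relation.Binary.PropositionalEquality.Core using (_≡_)
open import Relation.Nullary.Negation.Core using (¬_)

private
  variable
    c ℓ : Level

module _ (R : RawRing c ℓ) where
  private
    module R = RawRing R
    open RawSemiringDefs R.rawSemiring using (sum)

  -- The empty list is 0 and a ∷ p is a + x·p, so trailing zeros may occur;
  -- equality compares all coefficients.
  coeff : List R.Carrier → ℕ → R.Carrier
  coeff []      _         = R.0#
  coeff (a ∷ _) zero      = a
  coeff (_ ∷ p) (ℕ.suc n) = coeff p n

  addPoly : List R.Carrier → List R.Carrier → List R.Carrier
  addPoly []      q       = q
  addPoly (a ∷ p) []      = a ∷ p
  addPoly (a ∷ p) (b ∷ q) = (a R.+ b) ∷ addPoly p q

  mulPoly : List R.Carrier → List R.Carrier → List R.Carrier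
  mulPoly []      q = []
  mulPoly (a ∷ p) q = addPoly (map (a R.*_) q) (R.0# ∷ mulPoly p q)

  Polynomial : RawRing c ℓ
  Polynomial = record
    { Carrier = List R.Carrier
    ; _≈_     = λ p q → ∀ n → coeff p n R.≈ coeff q n
    ; _+_     = addPoly
    ; _*_     = mulPoly
    ; -_      = map R.-_
    ; 0#      = []
    ; 1#      = R.1# ∷ []
    }

  PowerSeries : RawRing c ℓ
  PowerSeries = record
    { Carrier = ℕ → R.Carrier
    ; _≈_     = λ f g → ∀ n → f n R.≈ g n
    ; _+_     = λ f g n → f n R.+ g n
    ; _*_     = λ f g n → sum {ℕ.suc n} λ i → f (toℕ i) R.* g (n ∸ toℕ i)
    ; -_      = λ f n → R.- f n
    ; 0#      = λ _ → R.0#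
    ; 1#      = λ { zero → R.1# ; (ℕ.suc _) → R.0# }
    }

  constSeries : R.Carrier → RawRing.Carrier PowerSeries
  constSeries a zero      = a
  constSeries a (ℕ.suc _) = R.0#

  seriesVar : RawRing.Carrier PowerSeries
  seriesVar (ℕ.suc zero) = R.1#
  seriesVar _            = R.0#

  constPoly : R.Carrier → RawRing.Carrier Polynomial
  constPoly a = a ∷ []

  polyVar : RawRing.Carrier Polynomial
  polyVar = R.0# ∷ R.1# ∷ []

-- The value of a polynomial over R at an element of an R-algebra A with
-- structure map φ.
evalPoly : ∀ {c′ ℓ′} {R : RawRing c ℓ} (A : RawRing c′ ℓ′) →
           (RawRing.Carrier R → RawRing.Carrier A) →
           RawRing.Carrier (Polynomial R) → RawRing.Carrier A → RawRing.Carrier A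
evalPoly A φ p a = foldr (λ b s → φ b A.+ a A.* s) A.0# p
  where module A = RawRing A

Field : Set₁
Field = HeytingField 0ℓ 0ℓ 0ℓ

rawRing : Field → RawRing 0ℓ 0ℓ
rawRing F = CommutativeRing.rawRing
  (HeytingCommutativeRing.commutativeRing (HeytingField.heytingCommutativeRing F))

ℚField : Field
ℚField = ℚ.heytingField

record Embedding (F G : Field) : Set where
  open RingMorphisms (rawRing F) (rawRing G)
  field
    ⟦_⟧                : HeytingField.Carrier F → HeytingField.Carrier G
    isRingHomomorphism : IsRingHomomorphism ⟦_⟧

open Embedding public using (⟦_⟧)

-- Additive ℚ-valued valuations, defined on the elements apart from 0 (the
-- valuation of 0 being +∞); the absolute value is |x| = p^(- v x).
record Valuation (F : Field) : Set where
  open HeytingField F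
  field
    v      : ∀ {x} → x # 0# → ℚ
    v-cong : ∀ {x y} (x#0 : x # 0#) (y#0 : y # 0#) → x ≈ y → v x#0 ≡ v y#0
    v-*    : ∀ {x y} (x#0 : x # 0#) (y#0 : y # 0#) (xy#0 : x * y # 0#) →
             v xy#0 ≡ v x#0 ℚ.+ v y#0
    v-+    : ∀ {x y} (x#0 : x # 0#) (y#0 : y # 0#) (x+y#0 : x + y # 0#) →
             v x#0 ℚ.⊓ v y#0 ℚ.≤ v x+y#0

  -- v (x - y) ≥ q, vacuous when x ≈ y
  Close : ℚ → Carrier → Carrier → Set
  Close q x y = (x-y#0 : (x - y) # 0#) → q ℚ.≤ v x-y#0

  Cauchy : (ℕ → Carrier) → Set
  Cauchy s = ∀ q → ∃ λ N → ∀ m n → N ℕ.≤ m → N ℕ.≤ n → Close q (s m) (s n)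

  ConvergesTo : (ℕ → Carrier) → Carrier → Set
  ConvergesTo s l = ∀ q → ∃ λ N → ∀ n → N ℕ.≤ n → Close q (s n) l

  Complete : Set
  Complete = ∀ s → Cauchy s → ∃ (ConvergesTo s)

Extends : ∀ {F G} → Valuation F → Valuation G → Embedding F G → Set
Extends {F} {G} vF vG ι =
  ∀ {x} (x#0 : x F.# F.0#) (ιx#0 : ⟦ ι ⟧ x G.# G.0#) → vG.v ιx#0 ≡ vF.v x#0
  where
  module F  = HeytingField F
  module G  = HeytingField G
  module vF = Valuation vF
  module vG = Valuation vG

record IsCompletion {F G} (vF : Valuation F) (vG : Valuation G) (ι : Embedding F G) : Set where
  field
    extends  : Extends vF vG ι
    dense    : ∀ y q → ∃ λ x → Valuation.Close vG q (⟦ ι ⟧ x) y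
    complete : Valuation.Complete vG

module _ (F : Field) where
  open HeytingField F
  open RawSemiringDefs (RawRing.rawSemiring (rawRing F)) using (sum; _^_)

  -- xⁿ + aₙ₋₁ xⁿ⁻¹ + … + a₀
  monicValue : ∀ {n} → Vector Carrier n → Carrier → Carrier
  monicValue {n} a x = x ^ n + sum λ i → a i * x ^ toℕ i

record IsAlgebraicClosure {F G} (ι : Embedding F G) : Set where
  private module G = HeytingField G
  field
    algebraic : ∀ y → ∃ λ n → ∃ λ (a : Vector (HeytingField.Carrier F) n) →
                monicValue G (λ i → ⟦ ι ⟧ (a i)) y G.≈ G.0#
    closed    : ∀ n (a : Vector G.Carrier (ℕ.suc n)) → ∃ λ y → monicValue G a y G.≈ G.0#

-- v (x) = m - n whenever x = pᵐ⁻ⁿ a / b with a, b integers prime to p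
IsPadicValuation : ℕ → Valuation ℚField → Set
IsPadicValuation p vℚ =
  ∀ {x} (x#0 : ¬ x ≡ ℚ.0ℚ) (m n : ℕ) (a b : ℤ) →
  ¬ (+ p) ℤ.∣ a → ¬ (+ p) ℤ.∣ b →
  x ℚ.* ((+ (p ℕ.^ n) ℤ.* b) ℚ./ 1) ≡ (+ (p ℕ.^ m) ℤ.* a) ℚ./ 1 →
  Valuation.v vℚ x#0 ≡ ((+ m) ℤ.- (+ n)) ℚ./ 1

-- A field ℂₚ together with its usual construction: ℚₚ is the completion of ℚ,
-- ℚ̄ₚ an algebraic closure of ℚₚ, and ℂₚ the completion of ℚ̄ₚ.  All
-- valuations are normalised by v (p) = 1, hence take values in ℚ.
record Is-ℂₚ (p : ℕ) (ℂₚ : Field) : Set₁ where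
  field
    vℚ           : Valuation ℚField
    vℚ-padic     : IsPadicValuation p vℚ

    ℚₚ           : Field
    vℚₚ          : Valuation ℚₚ
    ℚ→ℚₚ         : Embedding ℚField ℚₚ
    ℚₚ-completes : IsCompletion vℚ vℚₚ ℚ→ℚₚ

    ℚ̄ₚ           : Field
    vℚ̄ₚ          : Valuation ℚ̄ₚ
    ℚₚ→ℚ̄ₚ        : Embedding ℚₚ ℚ̄ₚ
    ℚ̄ₚ-closure   : IsAlgebraicClosure ℚₚ→ℚ̄ₚ
    ℚ̄ₚ-extends   : Extends vℚₚ vℚ̄ₚ ℚₚ→ℚ̄ₚ

    vℂₚ          : Valuation ℂₚ
    ℚ̄ₚ→ℂₚ        : Embedding ℚ̄ₚ ℂₚ
    ℂₚ-completes : IsCompletion vℚ̄ₚ vℂₚ ℚ̄ₚ→ℂₚ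

  ℚ→ℂₚ : ℚ → HeytingField.Carrier ℂₚ
  ℚ→ℂₚ x = ⟦ ℚ̄ₚ→ℂₚ ⟧ (⟦ ℚₚ→ℚ̄ₚ ⟧ (⟦ ℚ→ℚₚ ⟧ x))

open Is-ℂₚ public using (ℚ→ℂₚ)

record DirichletCharacter (F : Field) (d : ℕ) : Set where
  open HeytingField F
  field
    χ        : ℤ → Carrier
    periodic : ∀ a → χ (a ℤ.+ + d) ≈ χ a
    χ-1      : χ (+ 1) ≈ 1#
    χ-*      : ∀ a b → χ (a ℤ.* b) ≈ χ a * χ b
    χ-zero   : ∀ a → ¬ ℤ.Coprime a (+ d) → χ a ≈ 0#

open DirichletCharacter public using (χ)

InducedFrom : ∀ {F d} → DirichletCharacter F d → ℕ → Set
InducedFrom {F} {d} X f =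
  Σ[ Y ∈ DirichletCharacter F f ] (∀ a → ℤ.Coprime a (+ d) → χ X a ≈ χ Y a)
  where open HeytingField F

Primitive : ∀ {F d} → DirichletCharacter F d → Set
Primitive {d = d} X = ∀ f → f ℕ.∣ d → InducedFrom X f → f ≡ d

IsRootOfUnity : (K : RawRing c ℓ) → RawRing.Carrier K → Set ℓ
IsRootOfUnity K η = ∃ λ n → NonZero n × (η ^ n ≈ 1#)
  where
  open RawRing K
  open RawSemiringDefs rawSemiring using (_^_)

invFactorial : ℕ → ℚ
invFactorial n = (+ 1 ℚ./ (n !)) ⦃ n ℕ.!≢0 ⦄

module _ (K : RawRing c ℓ) (fromℚ : ℚ → RawRing.Carrier K) where
  private
    module K  = RawRing K
    module Kᵈ = RawSemiringDefs K.rawSemiring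

    K[x] : RawRing c ℓ
    K[x] = Polynomial K
    module P  = RawRing K[x]
    module Pᵈ = RawSemiringDefs P.rawSemiring

    K[x]⟦t⟧ : RawRing c ℓ
    K[x]⟦t⟧ = PowerSeries K[x]
    module S  = RawRing K[x]⟦t⟧
    module Sᵈ = RawSemiringDefs S.rawSemiring

  -- Σ fₙ tⁿ/n!
  egf : (ℕ → P.Carrier) → S.Carrier
  egf f n = constPoly K (fromℚ (invFactorial n)) P.* f n

  -- e^{at}
  exp : P.Carrier → S.Carrier
  exp a = egf (a Pᵈ.^_)

  const : K.Carrier → S.Carrier
  const a = constSeries K[x] (constPoly K a)

  -- The defining identity with the denominator cleared; η^d e^{dt} - 1 is a
  -- non-zero element of the domain K[x]⟦t⟧ when K is a field of characteristic
  -- zero and η ≠ 0, so the identity determines the sequence Bₙ.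
  IsTwistedBernoulli : ℕ → (ℤ → K.Carrier) → K.Carrier → (ℕ → P.Carrier) → Set ℓ
  IsTwistedBernoulli d X η B =
    (const (η Kᵈ.^ d) S.* exp (d Pᵈ.× P.1#) S.+ S.- S.1#) S.* egf B
      S.≈
    seriesVar K[x] S.* exp (polyVar K) S.*
      Sᵈ.sum {d} (λ a → const (X (+ toℕ a)) S.* const (η Kᵈ.^ toℕ a)
                          S.* exp (toℕ a Pᵈ.× P.1#))

multinomial : ℕ → ℕ → ℕ → ℕ → ℕ
multinomial n k l m = ((n !) ℕ./ (k ! ℕ.* l ! ℕ.* m !))
  ⦃ ℕ.m*n≢0 (k ! ℕ.* l !) (m !) ⦃ k ℕ.!* l !≢0 ⦄ ⦃ m ℕ.!≢0 ⦄ ⦄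

module Polynomial₃ (K : RawRing c ℓ) where

  K[y₁] K[y₁,y₂] K[y₁,y₂,y₃] : RawRing c ℓ
  K[y₁]       = Polynomial K
  K[y₁,y₂]    = Polynomial K[y₁]
  K[y₁,y₂,y₃] = Polynomial K[y₁,y₂]

  open RawRing K[y₁,y₂,y₃] public using (_≈_) renaming (Carrier to Carrier₃; _*_ to _·_)
  open RawSemiringDefs (RawRing.rawSemiring K[y₁,y₂,y₃]) public
    using () renaming (_×_ to infixr 8 _•_)
  open RawSemiringDefs (RawRing.rawSemiring K[y₁,y₂,y₃]) using (sum)

  y₁ y₂ y₃ : Carrier₃
  y₁ = constPoly K[y₁,y₂] (constPoly K[y₁] (polyVar K))
  y₂ = constPoly K[y₁,y₂] (polyVar K[y₁])
  y₃ = polyVar K[y₁,y₂]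

  const₃ : RawRing.Carrier K → Carrier₃
  const₃ a = constPoly K[y₁,y₂] (constPoly K[y₁] (constPoly K a))

  infix 9 _⟨_⟩
  _⟨_⟩ : RawRing.Carrier (Polynomial K) → Carrier₃ → Carrier₃
  p ⟨ a ⟩ = evalPoly {R = K} K[y₁,y₂,y₃] const₃ p a

  ∑[k+l+m≡_] : ℕ → (ℕ → ℕ → ℕ → Carrier₃) → Carrier₃
  ∑[k+l+m≡ n ] f =
    sum {ℕ.suc n} λ k → sum {ℕ.suc (n ∸ toℕ k)} λ l →
      f (toℕ k) (toℕ l) (n ∸ toℕ k ∸ toℕ l)

{-# OPTIONS --safe #-}

-- Let F_η(x,t) = Σ B_{n,χ,η}(x) tⁿ/n!.  Its defining identity at x = a is e^{at}
-- times the one at x = 0, and η^d e^{dt} - 1 is cancellable, even when η^d = 1;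
-- hence F_η(a,t) = e^{at} F_η(0,t).  The first sum is n! times the coefficient
-- of tⁿ in
--   F_{ξ^{w₂w₃}}(w₁y₁, w₂w₃t) F_{ξ^{w₁w₃}}(w₂y₂, w₁w₃t) F_{ξ^{w₁w₂}}(w₃y₃, w₁w₂t),
-- which equals e^{w₁w₂w₃(y₁+y₂+y₃)t} times three factors free of the yᵢ.  The
-- other sums arise from it by permuting the wᵢ, which only permutes those factors.

module Submission where

open import Defs
open import Algebra.Apartness.Bundles using (HeytingField; HeytingCommutativeRing)
open import Algebra.Bundles using (CommutativeRing; Semiring)
open import Algebra.Bundles.Raw using (RawRing)
import Algebra.Construct.Pointwise as Pointwise
import Algebra.Definitions.RawSemiring as RawSemiringDefs
open import Algebra.Definitions.RawSemiring using () renaming (_^_ to pow)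
import Algebra.Morphism.Construct.Composition as Composition
import Algebra.Morphism.RingMonomorphism as RingMonomorphism
open import Algebra.Morphism.Structures using (module RingMorphisms; IsRingMonomorphism)
import Algebra.Properties.CommutativeSemigroup as CommutativeSemigroupProperties
import Algebra.Properties.CommutativeSemiring.Exp as Exp
import Algebra.Properties.Group as GroupProperties
import Algebra.Properties.Semiring.Mult as SemiringMult
import Algebra.Properties.Semiring.Sum as SemiringSum
import Algebra.Structures as Structures
open import Data.Fin.Base as Fin using (Fin; toℕ)
open import Data.Fin.Properties using (toℕ≤pred[n])
open import Data.Integer.Base using (ℤ; +_)
import Data.Integer.Properties as ℤ
import Data.Integer.Solver as ℤ
open import Data.List.Base using ([]; _∷_; map)
open import Data.Nat.Base as ℕ using (ℕ; zero; suc; NonZero; _∸_; _!)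
import Data.Nat.Combinatorics as ℕ
open import Data.Nat.Coprimality using (Coprime)
import Data.Nat.Divisibility as ℕ
open import Data.Nat.Divisibility using (_∣_)
import Data.Nat.DivMod as ℕ
open import Data.Nat.Primality using (Prime)
import Data.Nat.Properties as ℕ
open import Data.Nat.Solver using (module +-*-Solver)
open import Data.Product.Base as Product using (_,_; proj₁; proj₂)
open import Data.Rational.Base as ℚ using (ℚ; 1ℚ)
import Data.Rational.Properties as ℚ
open import Data.Rational.Unnormalised.Base as ℚᵘ using (mkℚᵘ; *≡*)
import Data.Rational.Unnormalised.Properties as ℚᵘ
open import Function.Base using (_∘_)
open import Level using (Level; 0ℓ)
open import Relation.Binary.PropositionalEquality as ≡ using (_≡_)
import Relation.Binary.Reasoning.Setoid as SetoidReasoning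
open import Relation.Nullary.Negation.Core using (¬_)

-- The defining identities live in `ℂₚ[x]⟦t⟧`, while the sums live in `ℂₚ[y₁,y₂,y₃]`. Substituting
-- for `x` is a ring homomorphism applied to each coefficient in `t`, so the argument is carried out
-- in `A⟦t⟧` for an arbitrary `ℂₚ`-algebra `A`, and `A` becomes the polynomial ring only at the end.
-- The substitution `t ↦ w₂w₃t` is what creates the symmetry. It turns the exponent `w₁y₁t` into
-- `w₁w₂w₃y₁t`, so the variable no longer remembers its weight. The factor left over has twist `ξ^s`
-- and scale `s` for the same product `s` of two weights, so a permutation of the weights moves it
-- as one piece. The main obstacle is cancelling the denominator: it must be done in `A⟦t⟧`, which
-- need not be a domain, and over a Heyting field, where equality is not decided. This is why `A` is
-- assumed to have equality stable under double negation.

private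
  variable
    c ℓ c′ ℓ′ c″ ℓ″ : Level

-- Homomorphisms of commutative rings

IsHom : (R : CommutativeRing c ℓ) (S : CommutativeRing c′ ℓ′) →
        (CommutativeRing.Carrier R → CommutativeRing.Carrier S) → Set _
IsHom R S = RingMorphisms.IsRingHomomorphism (CommutativeRing.rawRing R) (CommutativeRing.rawRing S)

module _ (R : CommutativeRing c ℓ) (S : CommutativeRing c′ ℓ′) where
  private
    module R = CommutativeRing R
    module S = CommutativeRing S

  -- Additivity settles zero and negation: `f 0 + f 0 = f 0` forces `f 0 = 0` in the additive group
  -- of `S`, and then `f (- x)` is an additive inverse of `f x`, hence the only one.
  mkHom : (f : R.Carrier → S.Carrier) →
          (∀ {x y} → x R.≈ y → f x S.≈ f y) →
          (∀ x y → f (x R.+ y) S.≈ f x S.+ f y) →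
          (∀ x y → f (x R.* y) S.≈ f x S.* f y) →
          f R.1# S.≈ S.1# → IsHom R S f
  mkHom f cong +-homo *-homo 1-homo = record
    { isSemiringHomomorphism = record
      { isNearSemiringHomomorphism = record
        { +-isMonoidHomomorphism = record
          { isMagmaHomomorphism = record
            { isRelHomomorphism = record { cong = cong }
            ; homo = +-homo
            }
          ; ε-homo = 0-homo
          }
        ; *-homo = *-homo
        }
      ; 1#-homo = 1-homo
      }
    ; -‿homo = λ x → inverseˡ-unique (f (R.- x)) (f x)
        (S.trans (S.sym (+-homo _ _)) (S.trans (cong (R.-‿inverseˡ x)) 0-homo))
    }
    where
    open GroupProperties S.+-group
    0-homo : f R.0# S.≈ S.0#
    0-homo = identityˡ-unique _ _
      (S.trans (S.sym (+-homo _ _)) (cong (R.+-identityˡ R.0#)))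

∘-isHom : (R : CommutativeRing c ℓ) (S : CommutativeRing c′ ℓ′) (T : CommutativeRing c″ ℓ″) →
          ∀ {f g} → IsHom R S f → IsHom S T g → IsHom R T (g ∘ f)
∘-isHom R S T = Composition.isRingHomomorphism λ {x} {y} {z} → CommutativeRing.trans T {x} {y} {z}

module HomProperties {R : CommutativeRing c ℓ} {S : CommutativeRing c′ ℓ′}
                     {f : CommutativeRing.Carrier R → CommutativeRing.Carrier S}
                     (hom : IsHom R S f) where
  private
    module R where
      open CommutativeRing R public
      open RawSemiringDefs (Semiring.rawSemiring semiring) public using (_×_; _^_; sum)
    module S where
      open CommutativeRing S public
      open RawSemiringDefs (Semiring.rawSemiring semiring) public using (_×_; _^_; sum)
  open RingMorphisms.IsRingHomomorphism hom public

  ×-homo : ∀ n x → f (n R.× x) S.≈ n S.× f x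
  ×-homo zero    x = 0#-homo
  ×-homo (suc n) x = S.trans (+-homo _ _) (S.+-congˡ (×-homo n x))

  ^-homo : ∀ x n → f (x R.^ n) S.≈ f x S.^ n
  ^-homo x zero    = 1#-homo
  ^-homo x (suc n) = S.trans (*-homo _ _) (S.*-congˡ (^-homo x n))

  sum-homo : ∀ {n} (v : Fin n → R.Carrier) → f (R.sum v) S.≈ S.sum (f ∘ v)
  sum-homo {zero}  v = 0#-homo
  sum-homo {suc n} v = S.trans (+-homo _ _) (S.+-congˡ (sum-homo (v ∘ Fin.suc)))

-- The ring of formal power series: laws, cancellation, rescaling of the variable

module SeriesProperties (R : CommutativeRing c ℓ) where
  open CommutativeRing R renaming (rawRing to raw)
  open RawRing (PowerSeries raw) using () renaming (_*_ to _⊛_; _≈_ to _≋_; _+_ to _⊕_; -_ to ⊖_; 0# to 𝟘; 1# to 𝟙)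
  open CommutativeSemigroupProperties +-commutativeSemigroup using ()
    renaming (interchange to +-interchange; x∙yz≈y∙xz to x+yz≈y+xz)
  open CommutativeSemigroupProperties *-commutativeSemigroup using (x∙yz≈y∙xz)
  open SetoidReasoning setoid

  Series : Set _
  Series = ℕ → Carrier

  tail : Series → Series
  tail f n = f (suc n)

  infixr 8 _·_
  _·_ : Carrier → Series → Series
  (a · f) n = a * f n

  -- (f ⊛ g) (suc n) computes to f 0 * g (suc n) + (tail f ⊛ g) n, so the ring
  -- laws follow by induction on the index, with the series generalised.
  ⊛-cong : ∀ {f f′ g g′} → f ≋ f′ → g ≋ g′ → f ⊛ g ≋ f′ ⊛ g′
  ⊛-cong p q zero    = +-congʳ (*-cong (p 0) (q 0))
  ⊛-cong p q (suc n) = +-cong (*-cong (p 0) (q (suc n))) (⊛-cong (p ∘ suc) q n)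

  ⊛-distribʳ : ∀ h f g → (f ⊕ g) ⊛ h ≋ (f ⊛ h) ⊕ (g ⊛ h)
  ⊛-distribʳ h f g zero = begin
    (f 0 + g 0) * h 0 + 0#             ≈⟨ +-cong (distribʳ _ _ _) (sym (+-identityˡ 0#)) ⟩
    f 0 * h 0 + g 0 * h 0 + (0# + 0#)  ≈⟨ +-interchange _ _ _ _ ⟩
    f 0 * h 0 + 0# + (g 0 * h 0 + 0#)  ∎
  ⊛-distribʳ h f g (suc n) = begin
    (f 0 + g 0) * h (suc n) + ((tail f ⊕ tail g) ⊛ h) n
      ≈⟨ +-cong (distribʳ _ _ _) (⊛-distribʳ h (tail f) (tail g) n) ⟩
    f 0 * h (suc n) + g 0 * h (suc n) + ((tail f ⊛ h) n + (tail g ⊛ h) n)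
      ≈⟨ +-interchange _ _ _ _ ⟩
    f 0 * h (suc n) + (tail f ⊛ h) n + (g 0 * h (suc n) + (tail g ⊛ h) n) ∎

  ·-⊛-assoc : ∀ a f g → (a · f) ⊛ g ≋ a · (f ⊛ g)
  ·-⊛-assoc a f g zero = begin
    a * f 0 * g 0 + 0#         ≈⟨ +-cong (*-assoc _ _ _) (sym (zeroʳ a)) ⟩
    a * (f 0 * g 0) + a * 0#   ≈⟨ distribˡ _ _ _ ⟨
    a * (f 0 * g 0 + 0#)       ∎
  ·-⊛-assoc a f g (suc n) = begin
    a * f 0 * g (suc n) + ((a · tail f) ⊛ g) n
      ≈⟨ +-cong (*-assoc _ _ _) (·-⊛-assoc a (tail f) g n) ⟩
    a * (f 0 * g (suc n)) + a * (tail f ⊛ g) n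
      ≈⟨ distribˡ _ _ _ ⟨
    a * (f 0 * g (suc n) + (tail f ⊛ g) n) ∎

  ⊛-zeroˡ : ∀ g → (λ _ → 0#) ⊛ g ≋ (λ _ → 0#)
  ⊛-zeroˡ g zero    = trans (+-congʳ (zeroˡ _)) (+-identityˡ 0#)
  ⊛-zeroˡ g (suc n) = trans (+-cong (zeroˡ _) (⊛-zeroˡ g n)) (+-identityˡ 0#)

  constSeries-⊛ : ∀ a g → constSeries raw a ⊛ g ≋ a · g
  constSeries-⊛ a g zero    = +-identityʳ _
  constSeries-⊛ a g (suc n) = trans (+-congˡ (⊛-zeroˡ g n)) (+-identityʳ _)

  ⊛-identityˡ : ∀ g → 𝟙 ⊛ g ≋ g
  ⊛-identityˡ g zero    = trans (+-identityʳ _) (*-identityˡ _)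
  ⊛-identityˡ g (suc n) = trans (+-cong (*-identityˡ _) (⊛-zeroˡ g n)) (+-identityʳ _)

  -- The product computes by stripping the head of the left factor. Commutativity exchanges the
  -- factors, so it needs this mirror recursion, which strips the head of the right one.
  ⊛-sucʳ : ∀ f g n → (f ⊛ g) (suc n) ≈ f (suc n) * g 0 + (f ⊛ tail g) n
  ⊛-sucʳ f g zero    = x+yz≈y+xz _ _ _
  ⊛-sucʳ f g (suc n) = begin
    f 0 * g (suc (suc n)) + (tail f ⊛ g) (suc n)
      ≈⟨ +-congˡ (⊛-sucʳ (tail f) g n) ⟩
    f 0 * g (suc (suc n)) + (f (suc (suc n)) * g 0 + (tail f ⊛ tail g) n)
      ≈⟨ x+yz≈y+xz _ _ _ ⟩
    f (suc (suc n)) * g 0 + (f ⊛ tail g) (suc n) ∎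

  ⊛-comm : ∀ f g → f ⊛ g ≋ g ⊛ f
  ⊛-comm f g zero    = +-congʳ (*-comm _ _)
  ⊛-comm f g (suc n) = begin
    f 0 * g (suc n) + (tail f ⊛ g) n ≈⟨ +-cong (*-comm _ _) (⊛-comm (tail f) g n) ⟩
    g (suc n) * f 0 + (g ⊛ tail f) n ≈⟨ ⊛-sucʳ g f n ⟨
    (g ⊛ f) (suc n)                  ∎

  ⊛-assoc : ∀ f g h → (f ⊛ g) ⊛ h ≋ f ⊛ (g ⊛ h)
  ⊛-assoc f g h zero = +-congʳ (begin
    (f 0 * g 0 + 0#) * h 0  ≈⟨ *-congʳ (+-identityʳ _) ⟩
    f 0 * g 0 * h 0         ≈⟨ *-assoc _ _ _ ⟩
    f 0 * (g 0 * h 0)       ≈⟨ *-congˡ (+-identityʳ _) ⟨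
    f 0 * (g 0 * h 0 + 0#)  ∎)
  ⊛-assoc f g h (suc n) = begin
    (f 0 * g 0 + 0#) * h (suc n) + (tail (f ⊛ g) ⊛ h) n
      -- By computation `tail (f ⊛ g)` is `(f 0 · tail g) ⊕ (tail f ⊛ g)`. Distributivity separates
      -- the two, and the induction hypothesis applies to the second.
      ≈⟨ +-cong (trans (*-congʳ (+-identityʳ _)) (*-assoc _ _ _))
                (⊛-distribʳ h (f 0 · tail g) (tail f ⊛ g) n) ⟩
    f 0 * (g 0 * h (suc n)) + (((f 0 · tail g) ⊛ h) n + ((tail f ⊛ g) ⊛ h) n)
      ≈⟨ +-congˡ (+-cong (·-⊛-assoc (f 0) (tail g) h n) (⊛-assoc (tail f) g h n)) ⟩
    f 0 * (g 0 * h (suc n)) + (f 0 * (tail g ⊛ h) n + (tail f ⊛ (g ⊛ h)) n)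
      ≈⟨ +-assoc _ _ _ ⟨
    f 0 * (g 0 * h (suc n)) + f 0 * (tail g ⊛ h) n + (tail f ⊛ (g ⊛ h)) n
      ≈⟨ +-congʳ (distribˡ _ _ _) ⟨
    (f ⊛ (g ⊛ h)) (suc n) ∎

  isCommutativeRingSeries : Structures.IsCommutativeRing _≋_ _⊕_ _⊛_ ⊖_ 𝟘 𝟙
  isCommutativeRingSeries = record
    { isRing = record
      { +-isAbelianGroup = Pointwise.isAbelianGroup ℕ +-isAbelianGroup
      ; *-cong = ⊛-cong
      ; *-assoc = ⊛-assoc
      ; *-identity = ⊛-identityˡ , λ g n → trans (⊛-comm g 𝟙 n) (⊛-identityˡ g n)
      ; distrib = (λ h f g n → trans (⊛-comm h (f ⊕ g) n)
                      (trans (⊛-distribʳ h f g n) (+-cong (⊛-comm f h n) (⊛-comm g h n))))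
                , ⊛-distribʳ
      }
    ; *-comm = ⊛-comm
    }

  -- Coefficient 0 gives `u 0 ≈ v 0` because `D 0` is a unit. In coefficient `suc k` the terms
  -- `u 0 * D (suc k)` and `v 0 * D (suc k)` then agree, and removing them leaves the same
  -- hypothesis for the tails.
  ⊛-cancelʳ : ∀ D {e} → e * D 0 ≈ 1# → ∀ u v → u ⊛ D ≋ v ⊛ D → u ≋ v
  ⊛-cancelʳ D {e} eD≈1 = cancel
    where
    cancel₀ : ∀ {x y} → x * D 0 ≈ y * D 0 → x ≈ y
    cancel₀ {x} {y} p = begin
      x              ≈⟨ *-identityˡ x ⟨
      1# * x         ≈⟨ *-congʳ eD≈1 ⟨
      e * D 0 * x    ≈⟨ trans (*-assoc _ _ _) (*-congˡ (*-comm _ _)) ⟩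
      e * (x * D 0)  ≈⟨ *-congˡ p ⟩
      e * (y * D 0)  ≈⟨ trans (*-assoc _ _ _) (*-congˡ (*-comm _ _)) ⟨
      e * D 0 * y    ≈⟨ *-congʳ eD≈1 ⟩
      1# * y         ≈⟨ *-identityˡ y ⟩
      y              ∎
    cancel-head : ∀ u v → u ⊛ D ≋ v ⊛ D → u 0 ≈ v 0
    cancel-head u v eq = cancel₀ (trans (sym (+-identityʳ _)) (trans (eq 0) (+-identityʳ _)))
    cancel : ∀ u v → u ⊛ D ≋ v ⊛ D → u ≋ v
    cancel u v eq zero    = cancel-head u v eq
    cancel u v eq (suc n) = cancel (tail u) (tail v)
      (λ k → GroupProperties.∙-cancelˡ +-group _ _ _
        (trans (eq (suc k)) (+-congʳ (*-congʳ (sym (cancel-head u v eq)))))) n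

  ⊛-cancelˡ : ∀ D {e} → e * D 0 ≈ 1# → ∀ u v → D ⊛ u ≋ D ⊛ v → u ≋ v
  ⊛-cancelˡ D eD≈1 u v eq = ⊛-cancelʳ D eD≈1 u v
    λ n → trans (⊛-comm u D n) (trans (eq n) (⊛-comm D v n))

  -- A series with zero constant term is `t` times its tail, and multiplication by `t` only shifts
  -- coefficients. So it suffices to cancel the tail, whose constant term is a unit.
  ⊛-cancelˡ-tail : ∀ D {e} → D 0 ≈ 0# → e * D 1 ≈ 1# → ∀ u v → D ⊛ u ≋ D ⊛ v → u ≋ v
  ⊛-cancelˡ-tail D D₀≈0 eD₁≈1 u v eq = ⊛-cancelˡ (tail D) eD₁≈1 u v
    λ n → trans (sym (drop u n)) (trans (eq (suc n)) (drop v n))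
    where
    drop : ∀ w n → (D ⊛ w) (suc n) ≈ (tail D ⊛ w) n
    drop w n = trans (+-congʳ (trans (*-congʳ D₀≈0) (zeroˡ _))) (+-identityˡ _)

  open RawSemiringDefs (RawRing.rawSemiring raw) using (_^_)

  -- The substitution `t ↦ at`.
  scale : Carrier → Series → Series
  scale a f n = a ^ n * f n

  scale-cong : ∀ a {f g} → f ≋ g → scale a f ≋ scale a g
  scale-cong a p n = *-congˡ (p n)

  scale-⊛ : ∀ a f g → scale a (f ⊛ g) ≋ scale a f ⊛ scale a g
  scale-⊛ a f g zero = begin
    1# * (f 0 * g 0 + 0#)            ≈⟨ *-identityˡ _ ⟩
    f 0 * g 0 + 0#                   ≈⟨ +-congʳ (*-cong (*-identityˡ _) (*-identityˡ _)) ⟨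
    1# * f 0 * (1# * g 0) + 0#       ∎
  scale-⊛ a f g (suc n) = begin
    a ^ suc n * (f 0 * g (suc n) + (tail f ⊛ g) n)
      ≈⟨ distribˡ _ _ _ ⟩
    a ^ suc n * (f 0 * g (suc n)) + a * a ^ n * (tail f ⊛ g) n
      ≈⟨ +-cong (x∙yz≈y∙xz _ _ _) (*-assoc _ _ _) ⟩
    f 0 * (a ^ suc n * g (suc n)) + a * scale a (tail f ⊛ g) n
      ≈⟨ +-cong (*-congʳ (sym (*-identityˡ _))) (*-congˡ (scale-⊛ a (tail f) g n)) ⟩
    1# * f 0 * (a ^ suc n * g (suc n)) + a * (scale a (tail f) ⊛ scale a g) n
      ≈⟨ +-congˡ (·-⊛-assoc a (scale a (tail f)) (scale a g) n) ⟨
    1# * f 0 * (a ^ suc n * g (suc n)) + ((a · scale a (tail f)) ⊛ scale a g) n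
      ≈⟨ +-congˡ (⊛-cong {g = scale a g} (λ k → *-assoc a (a ^ k) (f (suc k))) (λ _ → refl) n) ⟨
    (scale a f ⊛ scale a g) (suc n) ∎

seriesRing : CommutativeRing c ℓ → CommutativeRing c ℓ
seriesRing R = record { isCommutativeRing = SeriesProperties.isCommutativeRingSeries R }

-- Polynomials as power series: the ring laws

module _ (R : CommutativeRing c ℓ) where
  open CommutativeRing R renaming (rawRing to raw)
  private
    P = Polynomial raw
    module P = RawRing P
    module S = RawRing (PowerSeries raw)
    cf : P.Carrier → ℕ → Carrier
    cf = coeff raw

  coeff-+ : ∀ p q → cf (p P.+ q) S.≈ cf p S.+ cf q
  coeff-+ []      q       n       = sym (+-identityˡ _)
  coeff-+ (a ∷ p) []      n       = sym (+-identityʳ _)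
  coeff-+ (a ∷ p) (b ∷ q) zero    = refl
  coeff-+ (a ∷ p) (b ∷ q) (suc n) = coeff-+ p q n

  coeff-map-* : ∀ a q n → cf (map (a *_) q) n ≈ a * cf q n
  coeff-map-* a []      n       = sym (zeroʳ a)
  coeff-map-* a (b ∷ q) zero    = refl
  coeff-map-* a (b ∷ q) (suc n) = coeff-map-* a q n

  coeff-* : ∀ p q → cf (p P.* q) S.≈ cf p S.* cf q
  coeff-* []      q n       = sym (SeriesProperties.⊛-zeroˡ R (cf q) n)
  coeff-* (a ∷ p) q zero    = trans (coeff-+ (map (a *_) q) _ 0) (+-congʳ (coeff-map-* a q 0))
  coeff-* (a ∷ p) q (suc n) = trans (coeff-+ (map (a *_) q) _ (suc n))
    (+-cong (coeff-map-* a q (suc n)) (coeff-* p q n))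

  coeff-neg : ∀ p → cf (P.- p) S.≈ S.- cf p
  coeff-neg []      n       = sym (GroupProperties.ε⁻¹≈ε +-group)
  coeff-neg (a ∷ p) zero    = refl
  coeff-neg (a ∷ p) (suc n) = coeff-neg p n

  coeff-1 : cf P.1# S.≈ S.1#
  coeff-1 zero    = refl
  coeff-1 (suc n) = refl

  -- Equality of polynomials is equality of coefficients by definition, so injectivity is immediate
  -- and the ring laws pull back from power series.
  coeff-isRingMonomorphism : IsRingMonomorphism P (PowerSeries raw) cf
  coeff-isRingMonomorphism = record
    { isRingHomomorphism = record
      { isSemiringHomomorphism = record
        { isNearSemiringHomomorphism = record
          { +-isMonoidHomomorphism = record
            { isMagmaHomomorphism = record
              { isRelHomomorphism = record { cong = λ p≈q → p≈q }
              ; homo = coeff-+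
              }
            ; ε-homo = λ _ → refl
            }
          ; *-homo = coeff-*
          }
        ; 1#-homo = coeff-1
        }
      ; -‿homo = coeff-neg
      }
    ; injective = λ p≈q → p≈q
    }

polynomialRing : CommutativeRing c ℓ → CommutativeRing c ℓ
polynomialRing R = record
  { isCommutativeRing = RingMonomorphism.isCommutativeRing (coeff-isRingMonomorphism R)
      (SeriesProperties.isCommutativeRingSeries R) }

constPoly-isHom : (R : CommutativeRing c ℓ) →
                  IsHom R (polynomialRing R) (constPoly (CommutativeRing.rawRing R))
constPoly-isHom R = mkHom R (polynomialRing R) (constPoly raw)
  (λ { x≈y zero → x≈y ; _ (suc _) → refl })
  (λ _ _ _ → refl)
  (λ { _ _ zero → sym (+-identityʳ _) ; _ _ (suc _) → refl })
  (λ _ → refl)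
  where open CommutativeRing R renaming (rawRing to raw)

-- Evaluation of polynomials in an algebra

module Evaluation {R : CommutativeRing c ℓ} {A : CommutativeRing c′ ℓ′}
                  {φ : CommutativeRing.Carrier R → CommutativeRing.Carrier A}
                  (hom : IsHom R A φ) where
  private
    module R = CommutativeRing R
    module P = CommutativeRing (polynomialRing R)
  open CommutativeRing A renaming (rawRing to raw)
  open HomProperties {R = R} {S = A} hom
  open CommutativeSemigroupProperties +-commutativeSemigroup using (interchange)
  open CommutativeSemigroupProperties *-commutativeSemigroup using (x∙yz≈y∙xz)
  open SetoidReasoning setoid

  eval : Carrier → P.Carrier → Carrier
  eval a p = evalPoly {R = R.rawRing} raw φ p a

  module _ (a : Carrier) where

    private
      ev = eval a

    -- A zero polynomial may be a nonempty list of zeros. This case arises in `eval-cong` when equal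
    -- polynomials have lists of different lengths.
    eval-0 : ∀ p → p P.≈ P.0# → ev p ≈ 0#
    eval-0 []      eq = refl
    eval-0 (b ∷ p) eq = begin
      φ b + a * ev p  ≈⟨ +-cong (trans (⟦⟧-cong (eq 0)) 0#-homo) (*-congˡ (eval-0 p (eq ∘ suc))) ⟩
      0# + a * 0#     ≈⟨ trans (+-identityˡ _) (zeroʳ a) ⟩
      0#              ∎

    eval-cong : ∀ {p q} → p P.≈ q → ev p ≈ ev q
    eval-cong {[]}    {q}     eq = sym (eval-0 q λ n → R.sym (eq n))
    eval-cong {b ∷ p} {[]}    eq = eval-0 (b ∷ p) eq
    eval-cong {b ∷ p} {e ∷ q} eq =
      +-cong (⟦⟧-cong (eq 0)) (*-congˡ (eval-cong {p} {q} (eq ∘ suc)))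

    eval-+ : ∀ p q → ev (p P.+ q) ≈ ev p + ev q
    eval-+ []      q       = sym (+-identityˡ _)
    eval-+ (b ∷ p) []      = sym (+-identityʳ _)
    eval-+ (b ∷ p) (e ∷ q) = begin
      φ (b R.+ e) + a * ev (p P.+ q)          ≈⟨ +-cong (+-homo b e) (*-congˡ (eval-+ p q)) ⟩
      φ b + φ e + a * (ev p + ev q)           ≈⟨ +-congˡ (distribˡ _ _ _) ⟩
      φ b + φ e + (a * ev p + a * ev q)       ≈⟨ interchange _ _ _ _ ⟩
      φ b + a * ev p + (φ e + a * ev q)       ∎

    eval-map-* : ∀ b q → ev (map (b R.*_) q) ≈ φ b * ev q
    eval-map-* b []      = sym (zeroʳ _)
    eval-map-* b (e ∷ q) = begin
      φ (b R.* e) + a * ev (map (b R.*_) q)  ≈⟨ +-cong (*-homo b e) (*-congˡ (eval-map-* b q)) ⟩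
      φ b * φ e + a * (φ b * ev q)           ≈⟨ +-congˡ (x∙yz≈y∙xz _ _ _) ⟩
      φ b * φ e + φ b * (a * ev q)           ≈⟨ distribˡ _ _ _ ⟨
      φ b * (φ e + a * ev q)                 ∎

    eval-* : ∀ p q → ev (p P.* q) ≈ ev p * ev q
    eval-* []      q = sym (zeroˡ _)
    eval-* (b ∷ p) q = begin
      ev (map (b R.*_) q P.+ (R.0# ∷ p P.* q))         ≈⟨ eval-+ (map (b R.*_) q) _ ⟩
      ev (map (b R.*_) q) + (φ R.0# + a * ev (p P.* q)) ≈⟨ +-cong (eval-map-* b q) (trans (+-congʳ 0#-homo) (+-identityˡ _)) ⟩
      φ b * ev q + a * ev (p P.* q)                     ≈⟨ +-congˡ (*-congˡ (eval-* p q)) ⟩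
      φ b * ev q + a * (ev p * ev q)                    ≈⟨ +-congˡ (*-assoc _ _ _) ⟨
      φ b * ev q + a * ev p * ev q                      ≈⟨ distribʳ _ _ _ ⟨
      (φ b + a * ev p) * ev q                           ∎

    eval-const : ∀ b → ev (constPoly R.rawRing b) ≈ φ b
    eval-const b = trans (+-congˡ (zeroʳ a)) (+-identityʳ _)

    eval-var : ev (polyVar R.rawRing) ≈ a
    eval-var = begin
      φ R.0# + a * (φ R.1# + a * 0#)  ≈⟨ +-cong 0#-homo (*-congˡ (trans (eval-const R.1#) 1#-homo)) ⟩
      0# + a * 1#                     ≈⟨ trans (+-identityˡ _) (*-identityʳ a) ⟩
      a                               ∎

    eval-isHom : IsHom (polynomialRing R) A ev
    eval-isHom = mkHom (polynomialRing R) A ev (λ {p} {q} → eval-cong {p} {q}) eval-+ eval-*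
      (trans (eval-const R.1#) 1#-homo)

mapSeries-isHom : {R : CommutativeRing c ℓ} {S : CommutativeRing c′ ℓ′}
                  {f : CommutativeRing.Carrier R → CommutativeRing.Carrier S} →
                  IsHom R S f → IsHom (seriesRing R) (seriesRing S) (f ∘_)
mapSeries-isHom {R = R} {S} {f} hom = mkHom (seriesRing R) (seriesRing S) (f ∘_)
  (λ p n → ⟦⟧-cong (p n)) (λ _ _ _ → +-homo _ _) ⊛-homo
  (λ { zero → 1#-homo ; (suc _) → 0#-homo })
  where
  open CommutativeRing S renaming (rawRing to raw)
  open HomProperties {R = R} {S = S} hom
  module R⟦t⟧ = CommutativeRing (seriesRing R)
  module S⟦t⟧ = CommutativeRing (seriesRing S)
  ⊛-homo : ∀ u v → (f ∘ (u R⟦t⟧.* v)) S⟦t⟧.≈ (f ∘ u) S⟦t⟧.* (f ∘ v)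
  ⊛-homo u v zero    = trans (+-homo _ _) (+-cong (*-homo _ _) 0#-homo)
  ⊛-homo u v (suc n) = trans (+-homo _ _) (+-cong (*-homo _ _) (⊛-homo (u ∘ suc) v n))

-- Arithmetic of multinomial coefficients, weights and unit fractions

multinomial-* : ∀ k l m → multinomial (k ℕ.+ l ℕ.+ m) k l m ℕ.* (k ! ℕ.* l ! ℕ.* m !) ≡ (k ℕ.+ l ℕ.+ m) !
multinomial-* k l m = ℕ.m/n*n≡m ⦃ ℕ.m*n≢0 (k ! ℕ.* l !) (m !) ⦃ k ℕ.!* l !≢0 ⦄ ⦃ m ℕ.!≢0 ⦄ ⦄
  -- `multinomial` is a floor division, exact because `k! l!` divides `(k+l)!` and `(k+l)! m!`
  -- divides `(k+l+m)!`.
  (ℕ.∣-trans (ℕ.*-monoˡ-∣ (m !) (binomial-∣ k l)) (binomial-∣ (k ℕ.+ l) m))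
  where
  binomial-∣ : ∀ a b → a ! ℕ.* b ! ℕ.∣ (a ℕ.+ b) !
  binomial-∣ a b = ≡.subst (λ e → e ! ℕ.* b ! ℕ.∣ (a ℕ.+ b) !) (ℕ.m+n∸n≡m a b)
    (ℕ.[n∸k]!k!∣n! (ℕ.m≤n+m b a))

ℕ-^-distrib-* : ∀ a b n → (a ℕ.* b) ℕ.^ n ≡ a ℕ.^ n ℕ.* b ℕ.^ n
ℕ-^-distrib-* a b zero    = ≡.refl
ℕ-^-distrib-* a b (suc n) rewrite ℕ-^-distrib-* a b n = ℕ.[m*n]*[o*p]≡[m*o]*[n*p] a b _ _

-- Each weight is raised to the sum of the two indices of the other slots. Regrouped by index, `k`,
-- `l`, `m` carry `vw`, `uw`, `uv`, the scales of `t` in the three generating functions.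
^-rearrange : ∀ u v w k l m →
  u ℕ.^ (l ℕ.+ m) ℕ.* v ℕ.^ (k ℕ.+ m) ℕ.* w ℕ.^ (k ℕ.+ l) ≡
  (v ℕ.* w) ℕ.^ k ℕ.* ((u ℕ.* w) ℕ.^ l ℕ.* (u ℕ.* v) ℕ.^ m)
^-rearrange u v w k l m
  rewrite ℕ.^-distribˡ-+-* u l m | ℕ.^-distribˡ-+-* v k m | ℕ.^-distribˡ-+-* w k l
        | ℕ-^-distrib-* v w k | ℕ-^-distrib-* u w l | ℕ-^-distrib-* u v m
  = solve 6 (λ ul um vk vm wk wl →
      ul :* um :* (vk :* vm) :* (wk :* wl) := vk :* wk :* (ul :* wl :* (um :* vm)))
      ≡.refl (u ℕ.^ l) (u ℕ.^ m) (v ℕ.^ k) (v ℕ.^ m) (w ℕ.^ k) (w ℕ.^ l)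
  where open +-*-Solver

fieldRing : Field → CommutativeRing 0ℓ 0ℓ
fieldRing F = HeytingCommutativeRing.commutativeRing (HeytingField.heytingCommutativeRing F)

ℚ-ring : CommutativeRing 0ℓ 0ℓ
ℚ-ring = fieldRing ℚField

module _ where
  open RawSemiringDefs (Semiring.rawSemiring (CommutativeRing.semiring ℚ-ring)) using (_×_)

  -- The induction runs through unnormalised fractions, where equality is cross multiplication and
  -- each step becomes a polynomial identity over the integers.
  toℚᵘ-×-1/ : ∀ m k → ℚ.toℚᵘ (m × (+ 1 ℚ./ suc k)) ℚᵘ.≃ mkℚᵘ (+ m) k
  toℚᵘ-×-1/ zero    k = *≡* ≡.refl
  toℚᵘ-×-1/ (suc m) k = begin
    ℚ.toℚᵘ (1/k ℚ.+ m × 1/k)              ≈⟨ ℚ.toℚᵘ-homo-+ 1/k (m × 1/k) ⟩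
    ℚ.toℚᵘ 1/k ℚᵘ.+ ℚ.toℚᵘ (m × 1/k)      ≈⟨ ℚᵘ.+-cong (ℚ.toℚᵘ-fromℚᵘ (mkℚᵘ (+ 1) k)) (toℚᵘ-×-1/ m k) ⟩
    mkℚᵘ (+ 1) k ℚᵘ.+ mkℚᵘ (+ m) k        ≈⟨ *≡* (solve 2 (λ m k →
      (con (+ 1) :* k :+ m :* k) :* k := (con (+ 1) :+ m) :* (k :* k)) ≡.refl (+ m) (+ suc k)) ⟩
    mkℚᵘ (+ suc m) k                      ∎
    where
    open SetoidReasoning ℚᵘ.≃-setoid
    open ℤ.+-*-Solver
    1/k = + 1 ℚ./ suc k

  n×1/n≡1 : ∀ n .{{_ : NonZero n}} → n × (+ 1 ℚ./ n) ≡ 1ℚ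
  n×1/n≡1 n@(suc k) = ℚ.toℚᵘ-injective (ℚᵘ.≃-trans (toℚᵘ-×-1/ n k)
    (*≡* (ℤ.*-comm (+ n) (+ 1))))

-- Exponential generating series and triple sums; `ι n` stands for `1/n!`

module ExponentialSeries (A : CommutativeRing c ℓ) (ι : ℕ → CommutativeRing.Carrier A) where
  open CommutativeRing A renaming (rawRing to raw)
  open SeriesProperties A
  open SemiringMult semiring
  open SemiringSum semiring using (sum; sum-cong-≋; *-distribˡ-sum)
  open Exp commutativeSemiring using (_^_; ^-distrib-*)
  open CommutativeSemigroupProperties *-commutativeSemigroup using (interchange; x∙yz≈y∙xz)
  open RawRing (PowerSeries raw) using () renaming (_*_ to _⊛_; _≈_ to _≋_; 1# to 𝟙)
  open SetoidReasoning setoid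

  egfS : Series → Series
  egfS f n = ι n * f n

  expS : Carrier → Series
  expS a = egfS (a ^_)

  scale-expS : ∀ a b → scale a (expS b) ≋ expS (a * b)
  scale-expS a b n = trans (x∙yz≈y∙xz _ _ _) (*-congˡ (sym (^-distrib-* a b n)))

  expS-cong : ∀ {a b} → a ≈ b → expS a ≋ expS b
  expS-cong a≈b n = *-congˡ (Exp.^-congˡ commutativeSemiring n a≈b)

  expS-0 : ι 0 ≈ 1# → expS 0# ≋ 𝟙
  expS-0 ι₀≈1 zero    = trans (*-identityʳ _) ι₀≈1
  expS-0 ι₀≈1 (suc n) = trans (*-congˡ (zeroˡ _)) (zeroʳ _)

  ×-*-interchange : ∀ m n x y → (m ℕ.* n) × (x * y) ≈ (m × x) * (n × y)
  ×-*-interchange m n x y = begin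
    (m ℕ.* n) × (x * y)  ≈⟨ ×-assocˡ _ m n ⟨
    m × (n × (x * y))    ≈⟨ ×-congʳ m (×-comm-* n x y) ⟨
    m × (x * (n × y))    ≈⟨ ×-assoc-* m x (n × y) ⟨
    (m × x) * (n × y)    ∎

  ×≈×1* : ∀ n x → n × x ≈ (n × 1#) * x
  ×≈×1* n x = trans (×-congʳ n (sym (*-identityˡ x))) (sym (×-assoc-* n 1# x))

  ^×≈×1^* : ∀ s n x → (s ℕ.^ n) × x ≈ (s × 1#) ^ n * x
  ^×≈×1^* s zero    x = trans (+-identityʳ x) (sym (*-identityˡ x))
  ^×≈×1^* s (suc n) x = begin
    (s ℕ.* s ℕ.^ n) × x                ≈⟨ ×-assocˡ x s (s ℕ.^ n) ⟨
    s × ((s ℕ.^ n) × x)                ≈⟨ ×≈×1* s _ ⟩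
    (s × 1#) * ((s ℕ.^ n) × x)         ≈⟨ *-congˡ (^×≈×1^* s n x) ⟩
    (s × 1#) * ((s × 1#) ^ n * x)      ≈⟨ *-assoc _ _ _ ⟨
    (s × 1#) ^ suc n * x               ∎

  ∑₃ : ℕ → (ℕ → ℕ → ℕ → Carrier) → Carrier
  ∑₃ n f = sum {suc n} λ k → sum {suc (n ∸ toℕ k)} λ l → f (toℕ k) (toℕ l) (n ∸ toℕ k ∸ toℕ l)

  -- The truncated subtractions are exact on the range of summation, so a termwise proof may assume
  -- `k + l + m ≡ n`; the multinomial identities are stated in that form.
  ∑₃-cong : ∀ n (f g : ℕ → ℕ → ℕ → Carrier) →
            (∀ k l m → k ℕ.+ l ℕ.+ m ≡ n → f k l m ≈ g k l m) → ∑₃ n f ≈ ∑₃ n g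
  ∑₃-cong n f g f≈g = sum-cong-≋ {suc n} λ k → sum-cong-≋ {suc (n ∸ toℕ k)} λ l →
    f≈g (toℕ k) (toℕ l) (n ∸ toℕ k ∸ toℕ l)
      (≡.trans (ℕ.+-assoc (toℕ k) (toℕ l) _)
        (≡.trans (≡.cong (toℕ k ℕ.+_) (ℕ.m+[n∸m]≡n (toℕ≤pred[n] l))) (ℕ.m+[n∸m]≡n (toℕ≤pred[n] k))))

  *-distribˡ-∑₃ : ∀ n x f → x * ∑₃ n f ≈ ∑₃ n λ k l m → x * f k l m
  *-distribˡ-∑₃ n x f = trans (*-distribˡ-sum {suc n} x λ k → sum {suc (n ∸ toℕ k)} λ l →
      f (toℕ k) (toℕ l) (n ∸ toℕ k ∸ toℕ l))
    (sum-cong-≋ {suc n} λ k → *-distribˡ-sum {suc (n ∸ toℕ k)} x λ l →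
      f (toℕ k) (toℕ l) (n ∸ toℕ k ∸ toℕ l))

  ⊛-⊛-∑₃ : ∀ f g h n → (f ⊛ (g ⊛ h)) n ≈ ∑₃ n λ k l m → f k * (g l * h m)
  ⊛-⊛-∑₃ f g h n = sum-cong-≋ {suc n} λ k → *-distribˡ-sum {suc (n ∸ toℕ k)} (f (toℕ k)) λ l →
    g (toℕ l) * h (n ∸ toℕ k ∸ toℕ l)

  module _ (!×ι≈1 : ∀ n → (n !) × ι n ≈ 1#) where

    -- Multiplying by `k! l! m! × (ι k * ι l * ι m)`, which is 1, trades the floor division in
    -- `multinomial` for inverse factorials in the ring.
    ι-multinomial : ∀ k l m → multinomial (k ℕ.+ l ℕ.+ m) k l m × 1# ≈
                              ((k ℕ.+ l ℕ.+ m) !) × (ι k * ι l * ι m)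
    ι-multinomial k l m = begin
      M × 1#                                              ≈⟨ ×-congʳ M unit ⟨
      M × ((k ! ℕ.* l ! ℕ.* m !) × (ι k * ι l * ι m))     ≈⟨ ×-assocˡ _ M _ ⟩
      (M ℕ.* (k ! ℕ.* l ! ℕ.* m !)) × (ι k * ι l * ι m)   ≈⟨ ×-congˡ (multinomial-* k l m) ⟩
      ((k ℕ.+ l ℕ.+ m) !) × (ι k * ι l * ι m)             ∎
      where
      M = multinomial (k ℕ.+ l ℕ.+ m) k l m
      unit : (k ! ℕ.* l ! ℕ.* m !) × (ι k * ι l * ι m) ≈ 1#
      unit = begin
        (k ! ℕ.* l ! ℕ.* m !) × (ι k * ι l * ι m)        ≈⟨ ×-*-interchange (k ! ℕ.* l !) (m !) _ _ ⟩
        ((k ! ℕ.* l !) × (ι k * ι l)) * ((m !) × ι m)      ≈⟨ *-cong (×-*-interchange (k !) (l !) _ _) (!×ι≈1 m) ⟩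
        ((k !) × ι k) * ((l !) × ι l) * 1#                   ≈⟨ *-identityʳ _ ⟩
        ((k !) × ι k) * ((l !) × ι l)                        ≈⟨ *-cong (!×ι≈1 k) (!×ι≈1 l) ⟩
        1# * 1#                                          ≈⟨ *-identityʳ 1# ⟩
        1#                                               ∎

    -- Splits a summand into `n!` and a term of a triple Cauchy product: each inverse factorial
    -- joins its generating series, and the powers of the weights become rescalings of `t`.
    multinomial-term : ∀ u v w (f g h : Series) k l m →
      (multinomial (k ℕ.+ l ℕ.+ m) k l m ℕ.*
        (u ℕ.^ (l ℕ.+ m) ℕ.* v ℕ.^ (k ℕ.+ m) ℕ.* w ℕ.^ (k ℕ.+ l))) × (f k * g l * h m) ≈
      (((k ℕ.+ l ℕ.+ m) !) × 1#) *
        (scale ((v ℕ.* w) × 1#) (egfS f) k *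
          (scale ((u ℕ.* w) × 1#) (egfS g) l * scale ((u ℕ.* v) × 1#) (egfS h) m))
    multinomial-term u v w f g h k l m = begin
      (M ℕ.* C) × X                                       ≈⟨ ×-assocˡ X M C ⟨
      M × (C × X)                                         ≈⟨ ×≈×1* M _ ⟩
      (M × 1#) * (C × X)                                  ≈⟨ *-congʳ (ι-multinomial k l m) ⟩
      (N × (ι k * ι l * ι m)) * (C × X)                   ≈⟨ ×-assoc-* N _ _ ⟩
      N × ((ι k * ι l * ι m) * (C × X))                   ≈⟨ ×≈×1* N _ ⟩
      (N × 1#) * ((ι k * ι l * ι m) * (C × X))            ≈⟨ *-congˡ (×-comm-* C _ _) ⟩
      (N × 1#) * (C × ((ι k * ι l * ι m) * X))            ≈⟨ *-congˡ (×-congʳ C (trans (interchange _ _ _ _) (*-congʳ (interchange _ _ _ _)))) ⟩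
      (N × 1#) * (C × (egfS f k * egfS g l * egfS h m))   ≈⟨ *-congˡ (×-cong (^-rearrange u v w k l m) (*-assoc _ _ _)) ⟩
      (N × 1#) * (((v ℕ.* w) ℕ.^ k ℕ.* ((u ℕ.* w) ℕ.^ l ℕ.* (u ℕ.* v) ℕ.^ m)) ×
        (egfS f k * (egfS g l * egfS h m)))
        ≈⟨ *-congˡ (trans (×-*-interchange ((v ℕ.* w) ℕ.^ k) _ _ _) (*-congˡ (×-*-interchange ((u ℕ.* w) ℕ.^ l) _ _ _))) ⟩
      (N × 1#) * ((((v ℕ.* w) ℕ.^ k) × egfS f k) * ((((u ℕ.* w) ℕ.^ l) × egfS g l) * (((u ℕ.* v) ℕ.^ m) × egfS h m)))
        ≈⟨ *-congˡ (*-cong (^×≈×1^* _ k _) (*-cong (^×≈×1^* _ l _) (^×≈×1^* _ m _))) ⟩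
      (N × 1#) * (scale ((v ℕ.* w) × 1#) (egfS f) k *
          (scale ((u ℕ.* w) × 1#) (egfS g) l * scale ((u ℕ.* v) × 1#) (egfS h) m)) ∎
      where
      M = multinomial (k ℕ.+ l ℕ.+ m) k l m
      N = (k ℕ.+ l ℕ.+ m) !
      C = u ℕ.^ (l ℕ.+ m) ℕ.* v ℕ.^ (k ℕ.+ m) ℕ.* w ℕ.^ (k ℕ.+ l)
      X = f k * g l * h m

    ∑₃-term : ∀ u v w (f g h : Series) n →
      (∑₃ n λ k l m → (multinomial n k l m ℕ.*
        (u ℕ.^ (l ℕ.+ m) ℕ.* v ℕ.^ (k ℕ.+ m) ℕ.* w ℕ.^ (k ℕ.+ l))) × (f k * g l * h m)) ≈
      ((n !) × 1#) * (scale ((v ℕ.* w) × 1#) (egfS f) ⊛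
        (scale ((u ℕ.* w) × 1#) (egfS g) ⊛ scale ((u ℕ.* v) × 1#) (egfS h))) n
    ∑₃-term u v w f g h n = begin
      ∑₃ n S                                                   ≈⟨ ∑₃-cong n S (λ k l m → ((n !) × 1#) * (F k * (G l * H m))) (λ { k l m ≡.refl → multinomial-term u v w f g h k l m }) ⟩
      (∑₃ n λ k l m → ((n !) × 1#) * (F k * (G l * H m)))      ≈⟨ *-distribˡ-∑₃ n ((n !) × 1#) (λ k l m → F k * (G l * H m)) ⟨
      ((n !) × 1#) * (∑₃ n λ k l m → F k * (G l * H m))        ≈⟨ *-congˡ (⊛-⊛-∑₃ F G H n) ⟨
      ((n !) × 1#) * (F ⊛ (G ⊛ H)) n                           ∎
      where
      S : ℕ → ℕ → ℕ → Carrier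
      S k l m = (multinomial n k l m ℕ.* (u ℕ.^ (l ℕ.+ m) ℕ.* v ℕ.^ (k ℕ.+ m) ℕ.* w ℕ.^ (k ℕ.+ l))) ×
        (f k * g l * h m)
      F = scale ((v ℕ.* w) × 1#) (egfS f)
      G = scale ((u ℕ.* w) × 1#) (egfS g)
      H = scale ((u ℕ.* v) × 1#) (egfS h)

-- Twisted Bernoulli generating functions evaluated in an algebra

Stable : CommutativeRing c ℓ → Set _
Stable R = ∀ x y → ¬ ¬ x ≈ y → x ≈ y
  where open CommutativeRing R

module TwistedBernoulli
  (F : Field) {q : ℚ → HeytingField.Carrier F} (q-isHom : IsHom ℚ-ring (fieldRing F) q)
  (A : CommutativeRing c ℓ)
  (stable : Stable A)
  {φ : HeytingField.Carrier F → CommutativeRing.Carrier A} (φ-isHom : IsHom (fieldRing F) A φ)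
  where
  private
    R = fieldRing F
    P = polynomialRing R
    module F where
      open HeytingField F public
      open Exp (CommutativeRing.commutativeSemiring R) public using (_^_)
    module P where
      open CommutativeRing P public
      open SemiringMult (CommutativeRing.semiring P) public using (_×_)
      open Exp (CommutativeRing.commutativeSemiring P) public using (_^_)
    module Aₜ where
      open CommutativeRing (seriesRing A) public
      open SemiringSum (CommutativeRing.semiring (seriesRing A)) public using (sum; sum-cong-≋)
    module Pₜ where
      open CommutativeRing (seriesRing P) public
      open SemiringSum (CommutativeRing.semiring (seriesRing P)) public using (sum)
    module φ = HomProperties {R = R} {S = A} φ-isHom
    K = rawRing F
  open CommutativeRing A renaming (rawRing to raw)
  open SeriesProperties A
  open Evaluation {R = R} {A = A} φ-isHom
  open SemiringMult semiring
  open CommutativeSemigroupProperties (CommutativeRing.*-commutativeSemigroup (seriesRing A))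
    using (interchange; x∙yz≈x∙zy; x∙yz≈y∙xz; x∙yz≈y∙zx; x∙yz≈z∙xy; x∙yz≈z∙yx)

  φq-isHom : IsHom ℚ-ring A (φ ∘ q)
  φq-isHom = ∘-isHom ℚ-ring R A q-isHom φ-isHom

  n×φq[1/n]≈1 : ∀ n .{{_ : NonZero n}} → n × φ (q (+ 1 ℚ./ n)) ≈ 1#
  n×φq[1/n]≈1 n = trans (sym (φq.×-homo n _)) (trans (φq.⟦⟧-cong (n×1/n≡1 n)) φq.1#-homo)
    where module φq = HomProperties {R = ℚ-ring} {S = A} φq-isHom

  ι : ℕ → Carrier
  ι n = φ (q (invFactorial n))

  !×ι≈1 : ∀ n → (n !) × ι n ≈ 1#
  !×ι≈1 n = n×φq[1/n]≈1 (n !) ⦃ n ℕ.!≢0 ⦄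

  open ExponentialSeries A ι

  ι₀≈1 : ι 0 ≈ 1#
  ι₀≈1 = trans (sym (+-identityʳ _)) (!×ι≈1 0)

  -- All coefficients come from constants, so every evaluation point yields this same series; hence
  -- identities at two points can be compared and the denominator cancelled.
  denominator : ℕ → F.Carrier → Series
  denominator d η = constSeries raw (φ (η F.^ d)) Aₜ.* expS (d × 1#) Aₜ.+ Aₜ.- Aₜ.1#

  characterSum : ℕ → (ℤ → F.Carrier) → F.Carrier → Series
  characterSum d X η = Aₜ.sum {d} λ a →
    constSeries raw (φ (X (+ toℕ a))) Aₜ.* constSeries raw (φ (η F.^ toℕ a)) Aₜ.* expS (toℕ a × 1#)

  module _ (a : Carrier) where
    private
      module ev = HomProperties {R = P} {S = A} (eval-isHom a)
      module evₜ = HomProperties {R = seriesRing P} {S = seriesRing A} (mapSeries-isHom {R = P} {S = A} (eval-isHom a))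

    eval-constSeries : ∀ b → eval a ∘ const K q b Aₜ.≈ constSeries raw (φ b)
    eval-constSeries b zero    = eval-const a b
    eval-constSeries b (suc n) = refl

    eval-egf : ∀ f → eval a ∘ egf K q f Aₜ.≈ egfS (eval a ∘ f)
    eval-egf f n = trans (ev.*-homo (constPoly K (q (invFactorial n))) (f n)) (*-congʳ (eval-const a _))

    eval-exp : ∀ b → eval a ∘ exp K q b Aₜ.≈ expS (eval a b)
    eval-exp b n = trans (eval-egf (b P.^_) n) (*-congˡ {ι n} (ev.^-homo b n))

    eval-exp-× : ∀ n → eval a ∘ exp K q (n P.× P.1#) Aₜ.≈ expS (n × 1#)
    eval-exp-× n = Aₜ.trans (eval-exp (n P.× P.1#))
      (expS-cong (trans (ev.×-homo n P.1#) (×-congʳ n ev.1#-homo)))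

    eval-seriesVar : eval a ∘ seriesVar (Polynomial K) Aₜ.≈ seriesVar raw
    eval-seriesVar zero          = refl
    eval-seriesVar (suc zero)    = ev.1#-homo
    eval-seriesVar (suc (suc n)) = refl

    -- Evaluation acts on series coefficient by coefficient as a ring homomorphism. Besides the
    -- Bernoulli series itself, only `e^{xt}` depends on `x`, and it becomes `e^{at}`.
    eval-isTwistedBernoulli : ∀ d X η B → IsTwistedBernoulli K q d X η B →
      denominator d η Aₜ.* egfS (eval a ∘ B) Aₜ.≈ seriesVar raw Aₜ.* expS a Aₜ.* characterSum d X η
    eval-isTwistedBernoulli d X η B eq = begin
      denominator d η Aₜ.* egfS (eval a ∘ B)
        ≈⟨ Aₜ.*-cong denominator-≈ (eval-egf B) ⟨
      (eval a ∘ D) Aₜ.* (eval a ∘ egf K q B)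
        ≈⟨ evₜ.*-homo D (egf K q B) ⟨
      eval a ∘ (D Pₜ.* egf K q B)
        ≈⟨ evₜ.⟦⟧-cong {D Pₜ.* egf K q B} {t Pₜ.* eˣᵗ Pₜ.* Pₜ.sum {d} summand} eq ⟩
      eval a ∘ (t Pₜ.* eˣᵗ Pₜ.* Pₜ.sum {d} summand)
        ≈⟨ Aₜ.trans (evₜ.*-homo (t Pₜ.* eˣᵗ) (Pₜ.sum summand)) (Aₜ.*-congʳ (evₜ.*-homo t eˣᵗ)) ⟩
      (eval a ∘ t) Aₜ.* (eval a ∘ eˣᵗ) Aₜ.* (eval a ∘ Pₜ.sum summand)
        ≈⟨ Aₜ.*-cong (Aₜ.*-cong eval-seriesVar (Aₜ.trans (eval-exp (polyVar K)) (expS-cong (eval-var a))))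
             (Aₜ.trans (evₜ.sum-homo summand) (Aₜ.sum-cong-≋ summand-≈)) ⟩
      seriesVar raw Aₜ.* expS a Aₜ.* characterSum d X η ∎
      where
      open SetoidReasoning Aₜ.setoid
      t eˣᵗ D : Pₜ.Carrier
      t   = seriesVar (Polynomial K)
      eˣᵗ = exp K q (polyVar K)
      cη = const K q (η F.^ d)
      D = cη Pₜ.* exp K q (d P.× P.1#) Pₜ.+ Pₜ.- Pₜ.1#
      cX cη^ eⁱᵗ summand : Fin d → Pₜ.Carrier
      cX i  = const K q (X (+ toℕ i))
      cη^ i = const K q (η F.^ toℕ i)
      eⁱᵗ i = exp K q (toℕ i P.× P.1#)
      summand i = cX i Pₜ.* cη^ i Pₜ.* eⁱᵗ i
      denominator-≈ : eval a ∘ D Aₜ.≈ denominator d η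
      denominator-≈ = Aₜ.trans (evₜ.+-homo (cη Pₜ.* exp K q (d P.× P.1#)) (Pₜ.- Pₜ.1#))
        (Aₜ.+-cong
          (Aₜ.trans (evₜ.*-homo cη (exp K q (d P.× P.1#)))
            (Aₜ.*-cong (eval-constSeries (η F.^ d)) (eval-exp-× d)))
          (Aₜ.trans (evₜ.-‿homo Pₜ.1#) (Aₜ.-‿cong evₜ.1#-homo)))
      summand-≈ : ∀ i → eval a ∘ summand i Aₜ.≈
        constSeries raw (φ (X (+ toℕ i))) Aₜ.* constSeries raw (φ (η F.^ toℕ i)) Aₜ.* expS (toℕ i × 1#)
      summand-≈ i = Aₜ.trans (evₜ.*-homo (cX i Pₜ.* cη^ i) (eⁱᵗ i))
        (Aₜ.*-cong
          (Aₜ.trans (evₜ.*-homo (cX i) (cη^ i))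
            (Aₜ.*-cong (eval-constSeries (X (+ toℕ i))) (eval-constSeries (η F.^ toℕ i))))
          (eval-exp-× (toℕ i)))

  denominator-0 : ∀ d η → denominator d η 0 ≈ φ (η F.^ d F.- F.1#)
  denominator-0 d η = begin
    φ (η F.^ d) * (ι 0 * 1#) + 0# + - 1#
      ≈⟨ +-cong (trans (+-identityʳ _) (trans (*-congˡ (trans (*-identityʳ _) ι₀≈1)) (*-identityʳ _))) (-‿cong (sym φ.1#-homo)) ⟩
    φ (η F.^ d) + - φ F.1#           ≈⟨ +-congˡ (φ.-‿homo F.1#) ⟨
    φ (η F.^ d) + φ (F.- F.1#)       ≈⟨ φ.+-homo _ _ ⟨
    φ (η F.^ d F.- F.1#)             ∎
    where open SetoidReasoning setoid

  denominator-1 : ∀ d η → denominator d η 1 ≈ φ (η F.^ d) * (d × 1#)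
  denominator-1 d η = begin
    (constSeries raw (φ (η F.^ d)) Aₜ.* expS (d × 1#)) 1 + - 0#
      ≈⟨ +-cong (constSeries-⊛ (φ (η F.^ d)) (expS (d × 1#)) 1) (GroupProperties.ε⁻¹≈ε +-group) ⟩
    φ (η F.^ d) * (ι 1 * ((d × 1#) * 1#)) + 0#
      ≈⟨ trans (+-identityʳ _) (*-congˡ (trans (*-cong ι₁≈1 (*-identityʳ _)) (*-identityˡ _))) ⟩
    φ (η F.^ d) * (d × 1#) ∎
    where
    open SetoidReasoning setoid
    ι₁≈1 : ι 1 ≈ 1#
    ι₁≈1 = trans (sym (+-identityʳ _)) (!×ι≈1 1)

  -- ηᵈ # 1 is not decidable, but the goal is ¬¬-stable, so both cases may be
  -- examined: either coefficient 0 of the denominator is a unit, or it vanishes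
  -- and coefficient 1 is d, which is a unit in characteristic 0.
  denominator-cancelˡ : ∀ d .{{_ : NonZero d}} η u v →
    denominator d η Aₜ.* u Aₜ.≈ denominator d η Aₜ.* v → u Aₜ.≈ v
  denominator-cancelˡ d η u v eq n = stable (u n) (v n) λ u≉v →
    let ηᵈ≈1 : η F.^ d F.≈ F.1#
        -- An apartness would make `ηᵈ - 1` invertible and so prove the goal, against `u≉v`.
        -- Tightness turns its refutation into an equality.
        ηᵈ≈1 = proj₁ (F.tight (η F.^ d) F.1#) λ ηᵈ#1 → u≉v (unit-case (F.#⇒invertible ηᵈ#1))
    in u≉v (one-case ηᵈ≈1)
    where
    D = denominator d η
    unit-case : _ → u n ≈ v n
    unit-case (e , e*≈1 , _) = ⊛-cancelˡ D {φ e}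
      (trans (*-congˡ (denominator-0 d η)) (trans (sym (φ.*-homo _ _)) (trans (φ.⟦⟧-cong e*≈1) φ.1#-homo)))
      u v eq n
    one-case : η F.^ d F.≈ F.1# → u n ≈ v n
    one-case ηᵈ≈1 = ⊛-cancelˡ-tail D {φ (q (+ 1 ℚ./ d))}
      (trans (denominator-0 d η) (trans (φ.⟦⟧-cong (F.trans (F.+-congʳ ηᵈ≈1) (F.-‿inverseʳ F.1#))) φ.0#-homo))
      (begin
        φ (q (+ 1 ℚ./ d)) * D 1                        ≈⟨ *-congˡ (denominator-1 d η) ⟩
        φ (q (+ 1 ℚ./ d)) * (φ (η F.^ d) * (d × 1#))   ≈⟨ *-congˡ (*-congʳ (trans (φ.⟦⟧-cong ηᵈ≈1) φ.1#-homo)) ⟩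
        φ (q (+ 1 ℚ./ d)) * (1# * (d × 1#))            ≈⟨ *-congˡ (*-identityˡ _) ⟩
        φ (q (+ 1 ℚ./ d)) * (d × 1#)                   ≈⟨ trans (×-comm-* d _ _) (×-congʳ d (*-identityʳ _)) ⟩
        d × φ (q (+ 1 ℚ./ d))                          ≈⟨ n×φq[1/n]≈1 d ⟩
        1#                                             ∎)
      u v eq n
      where open SetoidReasoning setoid

  egf-eval-factor : ∀ d .{{_ : NonZero d}} X η B → IsTwistedBernoulli K q d X η B →
    ∀ a → egfS (eval a ∘ B) Aₜ.≈ expS a Aₜ.* egfS (eval 0# ∘ B)
  egf-eval-factor d X η B bern a =
    denominator-cancelˡ d η (egfS (eval a ∘ B)) (expS a Aₜ.* egfS (eval 0# ∘ B)) (begin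
      D Aₜ.* egfS (eval a ∘ B)                          ≈⟨ eval-isTwistedBernoulli a d X η B bern ⟩
      t Aₜ.* expS a Aₜ.* H                              ≈⟨ Aₜ.trans (Aₜ.*-congʳ {H} (Aₜ.*-comm t (expS a))) (Aₜ.*-assoc (expS a) t H) ⟩
      -- Inserting `e^{0t} = 1` makes the bracket the right side of the identity evaluated at 0.
      expS a Aₜ.* (t Aₜ.* H)                            ≈⟨ Aₜ.*-congˡ {expS a} (Aₜ.*-congʳ {H} (Aₜ.trans (Aₜ.*-congˡ {t} (expS-0 ι₀≈1)) (Aₜ.*-identityʳ t))) ⟨
      expS a Aₜ.* (t Aₜ.* expS 0# Aₜ.* H)               ≈⟨ Aₜ.*-congˡ {expS a} (eval-isTwistedBernoulli 0# d X η B bern) ⟨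
      expS a Aₜ.* (D Aₜ.* egfS (eval 0# ∘ B))           ≈⟨ x∙yz≈y∙xz (expS a) D (egfS (eval 0# ∘ B)) ⟩
      D Aₜ.* (expS a Aₜ.* egfS (eval 0# ∘ B))           ∎)
    where
    open SetoidReasoning Aₜ.setoid
    D = denominator d η
    t = seriesVar raw
    H = characterSum d X η

  scaledNumbers : ℕ → (ℕ → P.Carrier) → Series
  scaledNumbers s B = scale (s × 1#) (egfS (eval 0# ∘ B))

  -- In the application `u` is one weight and `s` the product of the other two, so
  -- `e^{(uy)(st)} = e^{Wyt}` is the same for all three choices. `W` comes with an equation because
  -- the product arises in different orders.
  scale-egf-eval : ∀ d .{{_ : NonZero d}} X η B → IsTwistedBernoulli K q d X η B →
    ∀ {W} u s → s ℕ.* u ≡ W → ∀ y →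
    scale (s × 1#) (egfS (eval (u × y) ∘ B)) Aₜ.≈ expS (W × y) Aₜ.* scaledNumbers s B
  scale-egf-eval d X η B bern u s ≡.refl y = begin
    scale (s × 1#) (egfS (eval (u × y) ∘ B))
      ≈⟨ scale-cong (s × 1#) (egf-eval-factor d X η B bern (u × y)) ⟩
    scale (s × 1#) (expS (u × y) Aₜ.* egfS (eval 0# ∘ B))
      ≈⟨ scale-⊛ (s × 1#) (expS (u × y)) (egfS (eval 0# ∘ B)) ⟩
    scale (s × 1#) (expS (u × y)) Aₜ.* scaledNumbers s B
      ≈⟨ Aₜ.*-congʳ {scaledNumbers s B} (Aₜ.trans (scale-expS (s × 1#) (u × y)) (expS-cong (trans (sym (×≈×1* s _)) (×-assocˡ y s u)))) ⟩
    expS ((s ℕ.* u) × y) Aₜ.* scaledNumbers s B ∎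
    where open SetoidReasoning Aₜ.setoid

  bernoulliSum : ∀ (u v w : ℕ) (y₁ y₂ y₃ : Carrier) (B₁ B₂ B₃ : ℕ → P.Carrier) → ℕ → Carrier
  bernoulliSum u v w y₁ y₂ y₃ B₁ B₂ B₃ n = ∑₃ n λ k l m →
    (multinomial n k l m ℕ.* (u ℕ.^ (l ℕ.+ m) ℕ.* v ℕ.^ (k ℕ.+ m) ℕ.* w ℕ.^ (k ℕ.+ l))) ×
      (eval (u × y₁) (B₁ k) * eval (v × y₂) (B₂ l) * eval (w × y₃) (B₃ m))

  -- The products `s₁`, `s₂`, `s₃`, `W` are arguments with equations so that each permutation of the
  -- weights can name them in one fixed order, and the resulting factors then coincide literally.
  bernoulliSum-factor : ∀ d .{{_ : NonZero d}} X η₁ η₂ η₃ B₁ B₂ B₃ →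
    IsTwistedBernoulli K q d X η₁ B₁ →
    IsTwistedBernoulli K q d X η₂ B₂ →
    IsTwistedBernoulli K q d X η₃ B₃ →
    ∀ u v w {s₁ s₂ s₃ W} → v ℕ.* w ≡ s₁ → u ℕ.* w ≡ s₂ → u ℕ.* v ≡ s₃ → u ℕ.* v ℕ.* w ≡ W →
    ∀ y₁ y₂ y₃ n → bernoulliSum u v w y₁ y₂ y₃ B₁ B₂ B₃ n ≈
      ((n !) × 1#) * (expS (W × y₁) Aₜ.* (expS (W × y₂) Aₜ.* expS (W × y₃)) Aₜ.*
        (scaledNumbers s₁ B₁ Aₜ.* (scaledNumbers s₂ B₂ Aₜ.* scaledNumbers s₃ B₃))) n
  bernoulliSum-factor d X η₁ η₂ η₃ B₁ B₂ B₃ b₁ b₂ b₃ u v w {s₁} {s₂} {s₃} {W} ≡.refl ≡.refl ≡.refl ≡.refl y₁ y₂ y₃ n =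
    trans (∑₃-term !×ι≈1 u v w (eval (u × y₁) ∘ B₁) (eval (v × y₂) ∘ B₂) (eval (w × y₃) ∘ B₃) n)
      (*-congˡ (rearranged n))
    where
    open SetoidReasoning Aₜ.setoid
    open +-*-Solver
    E₁ = expS (W × y₁)
    E₂ = expS (W × y₂)
    E₃ = expS (W × y₃)
    G₁ = scaledNumbers s₁ B₁
    G₂ = scaledNumbers s₂ B₂
    G₃ = scaledNumbers s₃ B₃
    rearranged : scale (s₁ × 1#) (egfS (eval (u × y₁) ∘ B₁)) Aₜ.*
        (scale (s₂ × 1#) (egfS (eval (v × y₂) ∘ B₂)) Aₜ.* scale (s₃ × 1#) (egfS (eval (w × y₃) ∘ B₃)))
      Aₜ.≈ E₁ Aₜ.* (E₂ Aₜ.* E₃) Aₜ.* (G₁ Aₜ.* (G₂ Aₜ.* G₃))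
    rearranged = begin
      scale (s₁ × 1#) (egfS (eval (u × y₁) ∘ B₁)) Aₜ.*
        (scale (s₂ × 1#) (egfS (eval (v × y₂) ∘ B₂)) Aₜ.* scale (s₃ × 1#) (egfS (eval (w × y₃) ∘ B₃)))
        ≈⟨ Aₜ.*-cong (scale-egf-eval d X η₁ B₁ b₁ u s₁ (solve 3 (λ u v w → v :* w :* u := u :* v :* w) ≡.refl u v w) y₁)
             (Aₜ.*-cong (scale-egf-eval d X η₂ B₂ b₂ v s₂ (solve 3 (λ u v w → u :* w :* v := u :* v :* w) ≡.refl u v w) y₂)
                        (scale-egf-eval d X η₃ B₃ b₃ w s₃ ≡.refl y₃)) ⟩
      E₁ Aₜ.* G₁ Aₜ.* (E₂ Aₜ.* G₂ Aₜ.* (E₃ Aₜ.* G₃))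
        ≈⟨ Aₜ.*-congˡ {E₁ Aₜ.* G₁} (interchange E₂ G₂ E₃ G₃) ⟩
      E₁ Aₜ.* G₁ Aₜ.* (E₂ Aₜ.* E₃ Aₜ.* (G₂ Aₜ.* G₃))
        ≈⟨ interchange E₁ G₁ (E₂ Aₜ.* E₃) (G₂ Aₜ.* G₃) ⟩
      E₁ Aₜ.* (E₂ Aₜ.* E₃) Aₜ.* (G₁ Aₜ.* (G₂ Aₜ.* G₃)) ∎

  -- The six permutations of the weights

  module _ (d : ℕ) .{{_ : NonZero d}} (X : ℤ → F.Carrier) (η₁ η₂ η₃ : F.Carrier)
    (B₁ B₂ B₃ : ℕ → P.Carrier)
    (b₁ : IsTwistedBernoulli K q d X η₁ B₁)
    (b₂ : IsTwistedBernoulli K q d X η₂ B₂)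
    (b₃ : IsTwistedBernoulli K q d X η₃ B₃)
    (w₁ w₂ w₃ : ℕ) (y₁ y₂ y₃ : Carrier) (n : ℕ) where
    private
      W = w₁ ℕ.* w₂ ℕ.* w₃
      E = expS (W × y₁) Aₜ.* (expS (W × y₂) Aₜ.* expS (W × y₃))
      G₁ = scaledNumbers (w₂ ℕ.* w₃) B₁
      G₂ = scaledNumbers (w₁ ℕ.* w₃) B₂
      G₃ = scaledNumbers (w₁ ℕ.* w₂) B₃
      -- The common value of the six sums. Each `Bᵢ` belongs to the product of the two weights other
      -- than `wᵢ`, so it moves along with `wᵢ`. The factor `E` is literally the same in all six,
      -- and only the `Gᵢ` are reordered.
      N = ((n !) × 1#) * (E Aₜ.* (G₁ Aₜ.* (G₂ Aₜ.* G₃))) n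

      reorder : ∀ {G} → G Aₜ.≈ G₁ Aₜ.* (G₂ Aₜ.* G₃) → ((n !) × 1#) * (E Aₜ.* G) n ≈ N
      reorder G≈ = *-congˡ (Aₜ.*-congˡ {E} G≈ n)

      open +-*-Solver

      S₁ = bernoulliSum w₁ w₂ w₃ y₁ y₂ y₃ B₁ B₂ B₃ n
      S₂ = bernoulliSum w₁ w₃ w₂ y₁ y₂ y₃ B₁ B₃ B₂ n
      S₃ = bernoulliSum w₂ w₁ w₃ y₁ y₂ y₃ B₂ B₁ B₃ n
      S₄ = bernoulliSum w₂ w₃ w₁ y₁ y₂ y₃ B₂ B₃ B₁ n
      S₅ = bernoulliSum w₃ w₁ w₂ y₁ y₂ y₃ B₃ B₁ B₂ n
      S₆ = bernoulliSum w₃ w₂ w₁ y₁ y₂ y₃ B₃ B₂ B₁ n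

      S₁≈N : S₁ ≈ N
      S₁≈N = bernoulliSum-factor d X η₁ η₂ η₃ B₁ B₂ B₃ b₁ b₂ b₃ w₁ w₂ w₃
        ≡.refl ≡.refl ≡.refl ≡.refl y₁ y₂ y₃ n

      S₂≈N : S₂ ≈ N
      S₂≈N = trans
        (bernoulliSum-factor d X η₁ η₃ η₂ B₁ B₃ B₂ b₁ b₃ b₂ w₁ w₃ w₂
          (ℕ.*-comm w₃ w₂) ≡.refl ≡.refl
          (solve 3 (λ u v w → u :* w :* v := u :* v :* w) ≡.refl w₁ w₂ w₃) y₁ y₂ y₃ n)
        (reorder (x∙yz≈x∙zy G₁ G₃ G₂))

      S₃≈N : S₃ ≈ N
      S₃≈N = trans
        (bernoulliSum-factor d X η₂ η₁ η₃ B₂ B₁ B₃ b₂ b₁ b₃ w₂ w₁ w₃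
          ≡.refl ≡.refl (ℕ.*-comm w₂ w₁)
          (solve 3 (λ u v w → v :* u :* w := u :* v :* w) ≡.refl w₁ w₂ w₃) y₁ y₂ y₃ n)
        (reorder (x∙yz≈y∙xz G₂ G₁ G₃))

      S₄≈N : S₄ ≈ N
      S₄≈N = trans
        (bernoulliSum-factor d X η₂ η₃ η₁ B₂ B₃ B₁ b₂ b₃ b₁ w₂ w₃ w₁
          (ℕ.*-comm w₃ w₁) (ℕ.*-comm w₂ w₁) ≡.refl
          (solve 3 (λ u v w → v :* w :* u := u :* v :* w) ≡.refl w₁ w₂ w₃) y₁ y₂ y₃ n)
        (reorder (x∙yz≈z∙xy G₂ G₃ G₁))

      S₅≈N : S₅ ≈ N
      S₅≈N = trans
        (bernoulliSum-factor d X η₃ η₁ η₂ B₃ B₁ B₂ b₃ b₁ b₂ w₃ w₁ w₂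
          ≡.refl (ℕ.*-comm w₃ w₂) (ℕ.*-comm w₃ w₁)
          (solve 3 (λ u v w → w :* u :* v := u :* v :* w) ≡.refl w₁ w₂ w₃) y₁ y₂ y₃ n)
        (reorder (x∙yz≈y∙zx G₃ G₁ G₂))

      S₆≈N : S₆ ≈ N
      S₆≈N = trans
        (bernoulliSum-factor d X η₃ η₂ η₁ B₃ B₂ B₁ b₃ b₂ b₁ w₃ w₂ w₁
          (ℕ.*-comm w₂ w₁) (ℕ.*-comm w₃ w₁) (ℕ.*-comm w₃ w₂)
          (solve 3 (λ u v w → w :* v :* u := u :* v :* w) ≡.refl w₁ w₂ w₃) y₁ y₂ y₃ n)
        (reorder (x∙yz≈z∙yx G₃ G₂ G₁))

    bernoulliSum-symmetric : (S₁ ≈ S₂) Product.× (S₂ ≈ S₃) Product.× (S₃ ≈ S₄) Product.× (S₄ ≈ S₅) Product.× (S₅ ≈ S₆)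
    bernoulliSum-symmetric =
        trans S₁≈N (sym S₂≈N) , trans S₂≈N (sym S₃≈N) , trans S₃≈N (sym S₄≈N)
      , trans S₄≈N (sym S₅≈N) , trans S₅≈N (sym S₆≈N)

-- Specialisation to polynomials in three variables over `ℂₚ`

fieldRing-stable : ∀ F → Stable (fieldRing F)
fieldRing-stable F x y ¬¬x≈y =
  -- By tightness equality is the negation of apartness, and negations are stable.
  proj₁ (tight x y) λ x#y → ¬¬x≈y λ x≈y → proj₂ (tight x y) x≈y x#y
  where open HeytingField F

polynomialRing-stable : (R : CommutativeRing c ℓ) → Stable R → Stable (polynomialRing R)
polynomialRing-stable R stable p q ¬¬p≈q n = stable (coeff raw p n) (coeff raw q n) λ pₙ≉qₙ → ¬¬p≈q λ p≈q → pₙ≉qₙ (p≈q n)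
  where open CommutativeRing R using () renaming (rawRing to raw)

-- Makes the Bernoulli identity available at the twists `ξ^{w₂w₃}`, `ξ^{w₁w₃}`, `ξ^{w₁w₂}`, since
-- `(ξ^w)^r = (ξ^r)^w = 1`.
power-isRootOfUnity : ∀ F r .{{_ : NonZero r}} {ξ} →
                      HeytingField._≈_ F (pow (RawRing.rawSemiring (rawRing F)) ξ r) (HeytingField.1# F) →
                      ∀ w → IsRootOfUnity (rawRing F) (pow (RawRing.rawSemiring (rawRing F)) ξ w)
power-isRootOfUnity F r {ξ} ξʳ≈1 w = r , ℕ.≢-nonZero (ℕ.≢-nonZero⁻¹ r) , (begin
  (ξ ^ w) ^ r    ≈⟨ ^-assocʳ ξ w r ⟩
  ξ ^ (w ℕ.* r)  ≈⟨ ^-congʳ ξ (ℕ.*-comm w r) ⟩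
  ξ ^ (r ℕ.* w)  ≈⟨ ^-assocʳ ξ r w ⟨
  (ξ ^ r) ^ w    ≈⟨ ^-congˡ w ξʳ≈1 ⟩
  1# ^ w         ≈⟨ 1^ w ⟩
  1#             ∎)
  where
  open CommutativeRing (fieldRing F) using (commutativeSemiring; setoid; 1#; _≈_; *-identityˡ; refl; trans)
  open Exp commutativeSemiring
  open SetoidReasoning setoid
  1^ : ∀ n → 1# ^ n ≈ 1#
  1^ zero    = refl
  1^ (suc n) = trans (*-identityˡ _) (1^ n)

ℚ→ℂₚ-isHom : ∀ {p ℂₚ} (isℂₚ : Is-ℂₚ p ℂₚ) → IsHom ℚ-ring (fieldRing ℂₚ) (ℚ→ℂₚ isℂₚ)
ℚ→ℂₚ-isHom {ℂₚ = ℂₚ} isℂₚ =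
  ∘-isHom ℚ-ring (fieldRing ℚ̄ₚ) (fieldRing ℂₚ)
    (∘-isHom ℚ-ring (fieldRing ℚₚ) (fieldRing ℚ̄ₚ)
      (Embedding.isRingHomomorphism ℚ→ℚₚ) (Embedding.isRingHomomorphism ℚₚ→ℚ̄ₚ))
    (Embedding.isRingHomomorphism ℚ̄ₚ→ℂₚ)
  where open Is-ℂₚ isℂₚ

open import Data.Nat.Base using (_+_; _*_; _^_)
open import Data.Product.Base using (_×_)

theorem4 :
  (p : ℕ) → Prime p →
  (ℂₚ : Field) (isℂₚ : Is-ℂₚ p ℂₚ) →
  (ℚ̄ : Field) (ℚ→ℚ̄ : Embedding ℚField ℚ̄) → IsAlgebraicClosure ℚ→ℚ̄ →
  (ι : Embedding ℚ̄ ℂₚ) →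
  (d : ℕ) .{{_ : NonZero d}} (X : DirichletCharacter ℚ̄ d) → Primitive X →
  (r : ℕ) .{{_ : NonZero r}} → Coprime r (p * d) →
  let module ℂ = HeytingField ℂₚ
      K = rawRing ℂₚ
      infixr 8 _^ᶜ_
      _^ᶜ_ : ℂ.Carrier → ℕ → ℂ.Carrier
      _^ᶜ_ = pow (RawRing.rawSemiring K)
      open Polynomial₃ K
  in
  (ξ : ℂ.Carrier) → ¬ ξ ℂ.≈ ℂ.1# → ξ ^ᶜ r ℂ.≈ ℂ.1# →
  (B : ℂ.Carrier → ℕ → RawRing.Carrier (Polynomial K)) →
  (∀ η → IsRootOfUnity K η → IsTwistedBernoulli K (ℚ→ℂₚ isℂₚ) d (λ a → ⟦ ι ⟧ (χ X a)) η (B η)) →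
  (w₁ w₂ w₃ : ℕ) .{{_ : NonZero w₁}} .{{_ : NonZero w₂}} .{{_ : NonZero w₃}} →
  ¬ r ∣ w₂ * w₃ → ¬ r ∣ w₁ * w₃ → ¬ r ∣ w₁ * w₂ →
  ∀ n →
  let S₁ = ∑[k+l+m≡ n ] λ k l m →
             (multinomial n k l m * (w₁ ^ (l + m) * w₂ ^ (k + m) * w₃ ^ (k + l))) •
             (B (ξ ^ᶜ (w₂ * w₃)) k ⟨ w₁ • y₁ ⟩ · B (ξ ^ᶜ (w₁ * w₃)) l ⟨ w₂ • y₂ ⟩ · B (ξ ^ᶜ (w₁ * w₂)) m ⟨ w₃ • y₃ ⟩)
      S₂ = ∑[k+l+m≡ n ] λ k l m →
             (multinomial n k l m * (w₁ ^ (l + m) * w₃ ^ (k + m) * w₂ ^ (k + l))) •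
             (B (ξ ^ᶜ (w₂ * w₃)) k ⟨ w₁ • y₁ ⟩ · B (ξ ^ᶜ (w₁ * w₂)) l ⟨ w₃ • y₂ ⟩ · B (ξ ^ᶜ (w₁ * w₃)) m ⟨ w₂ • y₃ ⟩)
      S₃ = ∑[k+l+m≡ n ] λ k l m →
             (multinomial n k l m * (w₂ ^ (l + m) * w₁ ^ (k + m) * w₃ ^ (k + l))) •
             (B (ξ ^ᶜ (w₁ * w₃)) k ⟨ w₂ • y₁ ⟩ · B (ξ ^ᶜ (w₂ * w₃)) l ⟨ w₁ • y₂ ⟩ · B (ξ ^ᶜ (w₁ * w₂)) m ⟨ w₃ • y₃ ⟩)
      S₄ = ∑[k+l+m≡ n ] λ k l m →
             (multinomial n k l m * (w₂ ^ (l + m) * w₃ ^ (k + m) * w₁ ^ (k + l))) •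
             (B (ξ ^ᶜ (w₁ * w₃)) k ⟨ w₂ • y₁ ⟩ · B (ξ ^ᶜ (w₁ * w₂)) l ⟨ w₃ • y₂ ⟩ · B (ξ ^ᶜ (w₂ * w₃)) m ⟨ w₁ • y₃ ⟩)
      S₅ = ∑[k+l+m≡ n ] λ k l m →
             (multinomial n k l m * (w₃ ^ (l + m) * w₁ ^ (k + m) * w₂ ^ (k + l))) •
             (B (ξ ^ᶜ (w₁ * w₂)) k ⟨ w₃ • y₁ ⟩ · B (ξ ^ᶜ (w₂ * w₃)) l ⟨ w₁ • y₂ ⟩ · B (ξ ^ᶜ (w₁ * w₃)) m ⟨ w₂ • y₃ ⟩)
      S₆ = ∑[k+l+m≡ n ] λ k l m →
             (multinomial n k l m * (w₃ ^ (l + m) * w₂ ^ (k + m) * w₁ ^ (k + l))) •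
             (B (ξ ^ᶜ (w₁ * w₂)) k ⟨ w₃ • y₁ ⟩ · B (ξ ^ᶜ (w₁ * w₃)) l ⟨ w₂ • y₂ ⟩ · B (ξ ^ᶜ (w₂ * w₃)) m ⟨ w₁ • y₃ ⟩)
  in
  (S₁ ≈ S₂) × (S₂ ≈ S₃) × (S₃ ≈ S₄) × (S₄ ≈ S₅) × (S₅ ≈ S₆)
theorem4 _ _ ℂₚ isℂₚ _ _ _ ι d X _ r _ ξ _ ξʳ≈1 B bern w₁ w₂ w₃ _ _ _ n =
  -- Over the iterated polynomial ring `A` with structure map `const₃`, the six instances of
  -- `bernoulliSum` unfold to the sums of the statement.
  TwistedBernoulli.bernoulliSum-symmetric ℂₚ (ℚ→ℂₚ-isHom isℂₚ) A stable const₃-isHom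
    d (λ a → ⟦ ι ⟧ (χ X a)) _ _ _ (B _) (B _) (B _)
    (bern _ (root (w₂ * w₃))) (bern _ (root (w₁ * w₃))) (bern _ (root (w₁ * w₂)))
    w₁ w₂ w₃ y₁ y₂ y₃ n
  where
  open Polynomial₃ (rawRing ℂₚ)
  R₀ R₁ R₂ A : CommutativeRing 0ℓ 0ℓ
  R₀ = fieldRing ℂₚ
  R₁ = polynomialRing R₀
  R₂ = polynomialRing R₁
  A  = polynomialRing R₂
  stable : Stable A
  stable = polynomialRing-stable R₂ (polynomialRing-stable R₁
    (polynomialRing-stable R₀ (fieldRing-stable ℂₚ)))
  const₃-isHom : IsHom R₀ A const₃
  const₃-isHom = ∘-isHom R₀ R₂ A (∘-isHom R₀ R₁ R₂ (constPoly-isHom R₀) (constPoly-isHom R₁))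
    (constPoly-isHom R₂)
  root = power-isRootOfUnity ℂₚ r ξʳ≈1
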